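{- For every nonnegative integer $n$ and every complex number $x$, $${}_3F_2\left[\begin{matrix} 3x,\ -1-3x,\ -n\\ -\tfrac12,\ -3n\end{matrix}\middle|\frac34\right]=\frac{1+3x}{2}\left[\begin{matrix} \frac13+x,\ \frac23-x\\ \frac13,\ \frac23\end{matrix}\right]_n+\frac12\left[\begin{matrix} \frac23+x,\ \frac13-x\\ \frac13,\ \frac23\end{matrix}\right]_n-\frac{3x}{2}\left[\begin{matrix} 1+x,\ -x\\ \frac13,\ \frac23\end{matrix}\right]_n.$$
   Context: For a complex number $a$ and a nonnegative integer $m$, $(a)_m=a(a+1)\cdots(a+m-1)$ with $(a)_0=1$. The bracket notation means $\left[\begin{matrix} a_1,\dots,a_r\\ b_1,\dots,b_s\end{matrix}\right]_m=\frac{(a_1)_m\cdots(a_r)_m}{(b_1)_m\cdots(b_s)_m}$. For a nonnegative integer $n$, ${}_3F_2\left[\begin{matrix} a,\ b,\ -n\\ d,\ e\end{matrix}\middle|z\right]=\sum_{k=0}^{n}\frac{(a)_k(b)_k(-n)_k}{k!\,(d)_k(e)_k}z^k$. -}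

module Defs where

open import Level using (Level; _⊔_) renaming (suc to lsuc)
open import Algebra.Bundles using (CommutativeRing)
open import Data.Nat using (ℕ; zero; suc)
open import Data.Nat.Base using (_!)
open import Relation.Nullary using (¬_)

-- A field of characteristic zero (e.g. ℂ), presented as a commutative ring
-- with a total inverse map _⁻¹ that is a genuine inverse on nonzero elements
-- (its value at 0 is irrelevant and never used below, since every
-- denominator occurring is nonzero in characteristic zero).
-- canonical image of a natural number in a ring: n ↦ 1 + 1 + ... + 1
ringFromℕ : ∀ {c ℓ} (R : CommutativeRing c ℓ) → ℕ → CommutativeRing.Carrier R
ringFromℕ R zero    = CommutativeRing.0# R
ringFromℕ R (suc n) = CommutativeRing._+_ R (CommutativeRing.1# R) (ringFromℕ R n)

record CharZeroField (c ℓ : Level) : Set (lsuc (c ⊔ ℓ)) where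
  field
    commutativeRing : CommutativeRing c ℓ
  open CommutativeRing commutativeRing public hiding (zero)
  infix 8 _⁻¹
  field
    _⁻¹       : Carrier → Carrier
    inverseʳ  : ∀ x → ¬ (x ≈ 0#) → (x * x ⁻¹) ≈ 1#
    charZero  : ∀ n → ¬ (ringFromℕ commutativeRing (suc n) ≈ 0#)

  fromℕ : ℕ → Carrier
  fromℕ = ringFromℕ commutativeRing

  infixl 7 _÷_
  _÷_ : Carrier → Carrier → Carrier
  a ÷ b = a * b ⁻¹

  pow : Carrier → ℕ → Carrier
  pow z zero    = 1#
  pow z (suc k) = pow z k * z

  poch : Carrier → ℕ → Carrier
  poch a zero    = 1#
  poch a (suc m) = poch a m * (a + fromℕ m)

  sumTo : ℕ → (ℕ → Carrier) → Carrier
  sumTo zero    f = f zero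
  sumTo (suc n) f = sumTo n f + f (suc n)

  F32 : Carrier → Carrier → ℕ → Carrier → Carrier → Carrier → Carrier
  F32 a b n d e z =
    sumTo n (λ k → ((poch a k * poch b k * poch (- fromℕ n) k)
                     ÷ (fromℕ (k !) * poch d k * poch e k)) * pow z k)

  bracket : Carrier → Carrier → Carrier → Carrier → ℕ → Carrier
  bracket a₁ a₂ b₁ b₂ m = (poch a₁ m * poch a₂ m) ÷ (poch b₁ m * poch b₂ m)

-- The left side L(n) = Σₖ t(n,k) is a terminating hypergeometric sum. Zeilberger's creative telescoping
-- provides polynomials A₀, …, A₃ in n and a term G(n,k), hypergeometric in k and vanishing at k = 0 and at
-- k = n + 4, with Σᵢ Aᵢ(n) t(n+i,k) = G(n,k+1) − G(n,k); summing over k gives Σᵢ Aᵢ(n) L(n+i) = 0. This needs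
-- the Pochhammer symbols (−3n−3i)ₖ in the denominators to stay nonzero up to k = n + 3, which holds for n ≥ 2.
-- Each of the three brackets on the right is hypergeometric in n, and for such a sequence the recurrence is a
-- polynomial identity, so the right side satisfies the same recurrence. Its leading coefficient never vanishes,
-- hence the two sides agree as soon as they agree for n = 0, …, 4. All polynomial identities are checked by the
-- ring solver; the certificate depends on x only through V = 3x(3x+1), reflecting the symmetry x ↦ −1/3 − x.
module Submission where

open import Defs
open import Data.Nat using (ℕ; zero; suc; _≤_; _<_; _∸_; _^_; _!; s≤s; z≤n)
import Data.Nat as N
import Data.Nat.Properties as N
import Data.Nat.Literals as ℕLiterals
open import Data.Nat.Induction using (<-rec)
open import Level using (Level)
open import Algebra.Bundles using (CommutativeRing)
open import Agda.Builtin.FromNat using (Number)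
open import Agda.Builtin.FromNeg using (Negative)
open import Data.Bool.Base using (Bool; T)
open import Data.Integer.Base as ℤ using (ℤ; +_; -[1+_]; _⊖_)
import Data.Integer.Properties as ℤ
import Data.Integer.Literals as ℤLiterals
open import Data.List.Base using (List; []; _∷_; map)
open import Data.Maybe.Base using (nothing)
open import Data.Product.Base using (_×_; _,_; proj₁; proj₂)
open import Data.Sum.Base using (inj₁; inj₂)
open import Data.Vec.Base using (Vec)
open import Data.Vec.N-ary using (N-ary; Eq; Eqʰ; curryⁿ)
open import Relation.Binary.Definitions using (tri<; tri≈; tri>)
open import Relation.Binary.PropositionalEquality as ≡ using (_≢_)
open import Relation.Nullary.Decidable using (does; yes; no)
open import Relation.Nullary.Negation using (contradiction)
open import Tactic.RingSolver.Core.AlmostCommutativeRing using (fromCommutativeRing)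
open import Tactic.RingSolver.Core.Expression using (Expr; Κ; Ι; _⊕_; _⊗_; _⊛_; ⊝_)
open import Tactic.RingSolver.Core.Polynomial.Parameters using (Homomorphism)

-- Polynomials with integer coefficients are written once over this signature and then read both in a ring
-- (ringSyntax) and as ring-solver expressions (exprSyntax).
record RingSyntax {a} (A : Set a) : Set a where
  infixl 6 _+_ _-_
  infixl 7 _*_
  infix  8 -_
  field
    _+_ _*_ : A → A → A
    -_      : A → A
    1#      : A
    κ       : ℤ → A

  _-_ : A → A → A
  x - y = x + - y

  κ⁺ : ℕ → A
  κ⁺ n = κ (+ n)

  shift : ℕ → A → A
  shift zero    N = N
  shift (suc i) N = 1# + shift i N

  ∏< : ℕ → (ℕ → A) → A
  ∏< zero    f = 1#
  ∏< (suc k) f = ∏< k f * f k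

  -- (s₀ + ⋯ + sₘ) (d₀ ⋯ dₘ₋₁) for the hypergeometric sequence with s₀ = 1 and sₖ₊₁ dₖ = sₖ uₖ.
  clearedSum : (u d : ℕ → A) → ℕ → A
  clearedSum u d zero    = 1#
  clearedSum u d (suc m) = clearedSum u d m * d m + ∏< (suc m) u

  horner : A → List A → A
  horner X []           = κ (+ 0)
  horner X (c ∷ [])     = c
  horner X (c ∷ d ∷ cs) = c + X * horner X (d ∷ cs)

  -- In a coefficient table the innermost lists run over the powers of N, the next level over those of V,
  -- and the outermost one over those of K.
  poly₂ : A → A → List (List ℤ) → A
  poly₂ N V rows = horner V (map (λ row → horner N (map κ row)) rows)

  poly₃ : A → A → A → List (List (List ℤ)) → A
  poly₃ N V K blocks = horner K (map (poly₂ N V) blocks)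

-- Evaluates to 1# itself, whereas Κ (+ 1) evaluates to 1# + 0#.
𝟙 : ∀ {m} → Expr ℤ m
𝟙 = Κ (+ 0) ⊛ 0

exprSyntax : ∀ {m} → RingSyntax (Expr ℤ m)
exprSyntax = record { _+_ = _⊕_ ; _*_ = _⊗_ ; -_ = ⊝_ ; 1# = 𝟙 ; κ = Κ }

-- The standard library's ring solver with coefficients in ℤ rather than in the ring itself: the certificate
-- has coefficients of up to nine digits, far beyond what the unary ringFromℕ can handle.
module IntegerCoefficientRingSolver {c ℓ : Level} (R : CommutativeRing c ℓ) where
  open CommutativeRing R
  open import Relation.Binary.Reasoning.Setoid setoid
  open import Algebra.Properties.Ring ring using (-‿involutive; -‿distribˡ-*; -‿distribʳ-*; -‿anti-homo-+; -0#≈0#)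
  open import Algebra.Properties.Semiring.Mult semiring using (×-homo-+; ×1-homo-*) renaming (_×_ to _×ᵣ_)

  ι : ℕ → Carrier
  ι = ringFromℕ R

  ι≈×1 : ∀ n → ι n ≈ n ×ᵣ 1#
  ι≈×1 zero    = refl
  ι≈×1 (suc n) = +-congˡ (ι≈×1 n)

  ι-+ : ∀ m n → ι (m N.+ n) ≈ ι m + ι n
  ι-+ m n = trans (ι≈×1 (m N.+ n)) (trans (×-homo-+ 1# m n) (sym (+-cong (ι≈×1 m) (ι≈×1 n))))

  ι-* : ∀ m n → ι (m N.* n) ≈ ι m * ι n
  ι-* m n = trans (ι≈×1 (m N.* n)) (trans (×1-homo-* m n) (sym (*-cong (ι≈×1 m) (ι≈×1 n))))

  fromℤ : ℤ → Carrier
  fromℤ (+ n)    = ι n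
  fromℤ -[1+ n ] = - ι (suc n)

  fromℤ-neg : ∀ i → fromℤ (ℤ.- i) ≈ - fromℤ i
  fromℤ-neg (+ zero)  = sym -0#≈0#
  fromℤ-neg (+ suc n) = refl
  fromℤ-neg -[1+ n ]  = sym (-‿involutive _)

  fromℤ-⊖ : ∀ m n → fromℤ (m ⊖ n) ≈ ι m - ι n
  fromℤ-⊖ m       zero    = sym (trans (+-congˡ -0#≈0#) (+-identityʳ _))
  fromℤ-⊖ zero    (suc n) = sym (+-identityˡ _)
  fromℤ-⊖ (suc m) (suc n) = begin
    fromℤ (suc m ⊖ suc n)     ≡⟨ ≡.cong fromℤ (ℤ.[1+m]⊖[1+n]≡m⊖n m n) ⟩
    fromℤ (m ⊖ n)             ≈⟨ fromℤ-⊖ m n ⟩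
    ι m - ι n                 ≈⟨ +-congʳ (+-identityˡ _) ⟨
    (0# + ι m) - ι n          ≈⟨ +-congʳ (+-congʳ (-‿inverseʳ 1#)) ⟨
    (1# - 1# + ι m) - ι n     ≈⟨ +-congʳ (+-assoc _ _ _) ⟩
    (1# + (- 1# + ι m)) - ι n ≈⟨ +-congʳ (+-congˡ (+-comm _ _)) ⟩
    (1# + (ι m - 1#)) - ι n   ≈⟨ +-congʳ (+-assoc _ _ _) ⟨
    (1# + ι m - 1#) - ι n     ≈⟨ +-assoc _ _ _ ⟩
    (1# + ι m) + (- 1# - ι n) ≈⟨ +-congˡ (-‿anti-homo-+ _ _) ⟨
    (1# + ι m) - (ι n + 1#)   ≈⟨ +-congˡ (-‿cong (+-comm _ _)) ⟩
    (1# + ι m) - (1# + ι n)   ∎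

  fromℤ-+ : ∀ i j → fromℤ (i ℤ.+ j) ≈ fromℤ i + fromℤ j
  fromℤ-+ (+ m)    (+ n)    = ι-+ m n
  fromℤ-+ (+ m)    -[1+ n ] = fromℤ-⊖ m (suc n)
  fromℤ-+ -[1+ m ] (+ n)    = trans (fromℤ-⊖ n (suc m)) (+-comm _ _)
  fromℤ-+ -[1+ m ] -[1+ n ] = begin
    - (1# + ι (suc (m N.+ n)))  ≈⟨ -‿cong (+-congˡ (ι-+ (suc m) n)) ⟩
    - (1# + (ι (suc m) + ι n))  ≈⟨ -‿cong (trans (sym (+-assoc _ _ _)) (trans (+-congʳ (+-comm _ _)) (+-assoc _ _ _))) ⟨
    - (ι (suc m) + (1# + ι n))  ≈⟨ trans (-‿anti-homo-+ _ _) (+-comm _ _) ⟩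
    - ι (suc m) + - ι (suc n)   ∎

  private
    fromℤ-pos*pos : ∀ m n → fromℤ (+ m ℤ.* + n) ≈ ι (m N.* n)
    fromℤ-pos*pos m n with m N.* n
    ... | zero  = refl
    ... | suc _ = refl

    fromℤ-pos*neg : ∀ m n → fromℤ (+ m ℤ.* -[1+ n ]) ≈ - ι (m N.* suc n)
    fromℤ-pos*neg zero    n = sym -0#≈0#
    fromℤ-pos*neg (suc m) n = refl

    fromℤ-neg*pos : ∀ m n → fromℤ (-[1+ m ] ℤ.* + n) ≈ - ι (suc m N.* n)
    fromℤ-neg*pos m zero    rewrite N.*-zeroʳ m = sym -0#≈0#
    fromℤ-neg*pos m (suc n) = refl

  fromℤ-* : ∀ i j → fromℤ (i ℤ.* j) ≈ fromℤ i * fromℤ j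
  fromℤ-* (+ m)    (+ n)    = trans (fromℤ-pos*pos m n) (ι-* m n)
  fromℤ-* (+ m)    -[1+ n ] =
    trans (fromℤ-pos*neg m n) (trans (-‿cong (ι-* m (suc n))) (-‿distribʳ-* _ _))
  fromℤ-* -[1+ m ] (+ n)    =
    trans (fromℤ-neg*pos m n) (trans (-‿cong (ι-* (suc m) n)) (-‿distribˡ-* _ _))
  fromℤ-* -[1+ m ] -[1+ n ] = begin
    ι (suc m N.* suc n)          ≈⟨ ι-* (suc m) (suc n) ⟩
    ι (suc m) * ι (suc n)        ≈⟨ -‿involutive _ ⟨
    - - (ι (suc m) * ι (suc n))  ≈⟨ -‿cong (-‿distribˡ-* _ _) ⟩
    - (- ι (suc m) * ι (suc n))  ≈⟨ -‿distribʳ-* _ _ ⟩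
    - ι (suc m) * - ι (suc n)    ∎

  private
    isZero : ℤ → Bool
    isZero i = does (i ℤ.≟ + 0)

    isZero-sound : ∀ i → T (isZero i) → 0# ≈ fromℤ i
    isZero-sound i t with i ℤ.≟ + 0
    ... | yes ≡.refl = refl

    homomorphism : Homomorphism _ _ c ℓ
    homomorphism = record
      { from          = record { rawRing = ℤ.+-*-rawRing ; isZero = isZero }
      ; to            = fromCommutativeRing R (λ _ → nothing)
      ; morphism      = record
        { ⟦_⟧    = fromℤ
        ; +-homo = fromℤ-+
        ; *-homo = fromℤ-*
        ; -‿homo = fromℤ-neg
        ; 0-homo = refl
        ; 1-homo = +-identityʳ _
        }
      ; Zero-C⟶Zero-R = isZero-sound
      }

  module Ops where
    open Tactic.RingSolver.Core.Expression.Eval rawRing fromℤ public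
    open import Tactic.RingSolver.Core.Polynomial.Base (Homomorphism.from homomorphism)
      renaming (ι to ιₚ)

    norm : ∀ {n} → Expr ℤ n → Poly n
    norm (Κ x)   = κ x
    norm (Ι x)   = ιₚ x
    norm (x ⊕ y) = norm x ⊞ norm y
    norm (x ⊗ y) = norm x ⊠ norm y
    norm (⊝ x)   = ⊟ norm x
    norm (x ⊛ i) = norm x ⊡ i

    ⟦_⇓⟧ : ∀ {n} → Expr ℤ n → Vec Carrier n → Carrier
    ⟦ expr ⇓⟧ = ⟦ norm expr ⟧ₚ
      where open import Tactic.RingSolver.Core.Polynomial.Semantics homomorphism renaming (⟦_⟧ to ⟦_⟧ₚ)

    correct : ∀ {n} (expr : Expr ℤ n) ρ → ⟦ expr ⇓⟧ ρ ≈ ⟦ expr ⟧ ρ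
    correct {n = n} = go
      where
      open import Tactic.RingSolver.Core.Polynomial.Homomorphism homomorphism
      open import Algebra.Properties.Semiring.Exp.TCOptimised semiring using (^-congˡ)
      go : ∀ (expr : Expr ℤ n) ρ → ⟦ expr ⇓⟧ ρ ≈ ⟦ expr ⟧ ρ
      go (Κ x)   ρ = κ-hom x ρ
      go (Ι x)   ρ = ι-hom x ρ
      go (x ⊕ y) ρ = trans (⊞-hom (norm x) (norm y) ρ) (+-cong (go x ρ) (go y ρ))
      go (x ⊗ y) ρ = trans (⊠-hom (norm x) (norm y) ρ) (*-cong (go x ρ) (go y ρ))
      go (⊝ x)   ρ = trans (⊟-hom (norm x) ρ) (-‿cong (go x ρ))
      go (x ⊛ i) ρ = trans (⊡-hom (norm x) i ρ) (^-congˡ i (go x ρ))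

    open import Relation.Binary.Reflection setoid Ι ⟦_⟧ ⟦_⇓⟧ correct public

  solve : ∀ (n : ℕ) (f : N-ary n (Expr ℤ n) (Expr ℤ n × Expr ℤ n)) →
          Eqʰ n _≈_ (curryⁿ (Ops.⟦_⇓⟧ (proj₁ (Ops.close n f)))) (curryⁿ (Ops.⟦_⇓⟧ (proj₂ (Ops.close n f)))) →
          Eq  n _≈_ (curryⁿ (Ops.⟦_⟧  (proj₁ (Ops.close n f)))) (curryⁿ (Ops.⟦_⟧  (proj₂ (Ops.close n f))))
  solve = Ops.solve

  infix 4 _⊜_
  _⊜_ : ∀ {n} → Expr ℤ n → Expr ℤ n → Expr ℤ n × Expr ℤ n
  _⊜_ = _,_

  ringSyntax : RingSyntax Carrier
  ringSyntax = record { _+_ = _+_ ; _*_ = _*_ ; -_ = -_ ; 1# = 1# ; κ = fromℤ }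

module Certificate {a} {A : Set a} (S : RingSyntax A) where
  -- Literal overloading stays local to this module: in scope around a solver call it would delay the arity
  -- argument of solve.
  open import Agda.Builtin.FromNat using (fromNat)
  open import Data.Unit.Base using (tt)
  open RingSyntax S

  instance
    ℕ-number : Number ℕ
    ℕ-number = ℕLiterals.number
    ℤ-number : Number ℤ
    ℤ-number = ℤLiterals.number
    ℤ-negative : Negative ℤ
    ℤ-negative = ℤLiterals.negative

  -- With V = 3x(3x+1), the summand t of the ₃F₂ has t(n,k+1) / t(n,k) = termNumerator n k V / termDenominator n k.
  termNumerator : A → A → A → A
  termNumerator N K V = κ 6 * (K * (K - 1#) - V) * (K - N)

  termDenominator : A → A → A
  termDenominator N K = κ 4 * (K + 1#) * (κ 2 * K - 1#) * (K - κ 3 * N)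

  shiftFactor : ℕ → A → A → A
  shiftFactor i N K =
    ∏< (3 ∸ i) (λ j → K - N - κ⁺ (i N.+ j N.+ 1)) * ∏< (3 N.* i) (λ j → K - κ 3 * N - κ⁺ (suc j))

  complementFactor : ℕ → A → A
  complementFactor i N = κ⁺ (3 ^ (3 ∸ i)) * ∏< (3 ∸ i) (λ j → factor (3 N.* (i N.+ j) N.+ 1) * factor (3 N.* (i N.+ j) N.+ 2))
    where
    factor : ℕ → A
    factor l = - (κ 3 * N) - κ⁺ l

  recurrence₀ : A → A → A
  recurrence₀ N V = poly₂ N V
    ( (0 ∷ -36 ∷ -360 ∷ -1377 ∷ -2511 ∷ -2187 ∷ -729 ∷ [])
    ∷ (12 ∷ 108 ∷ 351 ∷ 486 ∷ 243 ∷ [])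
    ∷ (-8 ∷ -27 ∷ -27 ∷ [])
    ∷ (1 ∷ [])
    ∷ [])

  recurrence₁ : A → A → A
  recurrence₁ N V = poly₂ N V
    ( (800 ∷ 6156 ∷ 18324 ∷ 27945 ∷ 23733 ∷ 10935 ∷ 2187 ∷ [])
    ∷ (-132 ∷ -810 ∷ -1674 ∷ -1458 ∷ -486 ∷ [])
    ∷ (6 ∷ 27 ∷ 27 ∷ [])
    ∷ [])

  recurrence₂ : A → A → A
  recurrence₂ N V = poly₂ N V
    ( (-3040 ∷ -21024 ∷ -53550 ∷ -66663 ∷ -44307 ∷ -15309 ∷ -2187 ∷ [])
    ∷ (120 ∷ 702 ∷ 1323 ∷ 972 ∷ 243 ∷ [])
    ∷ [])

  recurrence₃ : A → A → A
  recurrence₃ N V = poly₂ N V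
    ( (2240 ∷ 14904 ∷ 35586 ∷ 40095 ∷ 23085 ∷ 6561 ∷ 729 ∷ [])
    ∷ [])

  certificateCore : A → A → A → A
  certificateCore N K V = poly₃ N V K
    ( ( (-1075200 ∷ -9841920 ∷ -36578880 ∷ -72679680 ∷ -84816720 ∷ -59719680 ∷ -24844320 ∷ -5598720 ∷ -524880 ∷ [])
      ∷ (-645120 ∷ -5475072 ∷ -18440640 ∷ -32482944 ∷ -32943024 ∷ -19852128 ∷ -6998400 ∷ -1329696 ∷ -104976 ∷ [])
      ∷ (-241920 ∷ -1811232 ∷ -5224968 ∷ -7801272 ∷ -6742278 ∷ -3507948 ∷ -1084752 ∷ -183708 ∷ -13122 ∷ [])
      ∷ [])
    ∷ ( (4444160 ∷ 39945216 ∷ 145605312 ∷ 284087088 ∷ 326321784 ∷ 226759824 ∷ 93335328 ∷ 20855232 ∷ 1942056 ∷ [])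
      ∷ (1827840 ∷ 14957184 ∷ 48283488 ∷ 81421200 ∷ 79124688 ∷ 45711216 ∷ 15431472 ∷ 2799360 ∷ 209952 ∷ [])
      ∷ (201600 ∷ 1422000 ∷ 3739284 ∷ 4889646 ∷ 3521070 ∷ 1421550 ∷ 301806 ∷ 26244 ∷ [])
      ∷ [])
    ∷ ( (-6227200 ∷ -54617760 ∷ -193548744 ∷ -366797808 ∷ -409709178 ∷ -277530300 ∷ -111700296 ∷ -24485652 ∷ -2243862 ∷ [])
      ∷ (-1344000 ∷ -10582080 ∷ -32503248 ∷ -51715584 ∷ -47043828 ∷ -25165080 ∷ -7733232 ∷ -1242216 ∷ -78732 ∷ [])
      ∷ (-40320 ∷ -268272 ∷ -640548 ∷ -721710 ∷ -415530 ∷ -118098 ∷ -13122 ∷ [])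
      ∷ [])
    ∷ ( (3812480 ∷ 32167248 ∷ 108718956 ∷ 195596370 ∷ 207138546 ∷ 133216002 ∷ 51078114 ∷ 10716300 ∷ 944784 ∷ [])
      ∷ (349440 ∷ 2593824 ∷ 7339896 ∷ 10525140 ∷ 8412660 ∷ 3793716 ∷ 901044 ∷ 87480 ∷ [])
      ∷ [])
    ∷ ( (-1079680 ∷ -8568048 ∷ -26726004 ∷ -43732386 ∷ -41670612 ∷ -23924322 ∷ -8145846 ∷ -1513404 ∷ -118098 ∷ [])
      ∷ (-26880 ∷ -178848 ∷ -427032 ∷ -481140 ∷ -277020 ∷ -78732 ∷ -8748 ∷ [])
      ∷ [])
    ∷ ( (129920 ∷ 945072 ∷ 2600532 ∷ 3606606 ∷ 2782350 ∷ 1211598 ∷ 278478 ∷ 26244 ∷ [])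
      ∷ [])
    ∷ ( (-4480 ∷ -29808 ∷ -71172 ∷ -80190 ∷ -46170 ∷ -13122 ∷ -1458 ∷ [])
      ∷ [])
    ∷ [])

  certificate : A → A → A → A
  certificate N K V = K * (κ 2 * K - κ 3) * (K - κ 3 * N - 1#) * certificateCore N K V

  telescopingLHS : A → A → A → A
  telescopingLHS N K V =
    ( recurrence₀ N V * complementFactor 0 N * shiftFactor 0 N K
    + recurrence₁ N V * complementFactor 1 N * shiftFactor 1 N K
    + recurrence₂ N V * complementFactor 2 N * shiftFactor 2 N K
    + recurrence₃ N V * complementFactor 3 N * shiftFactor 3 N K) * termDenominator N K

  telescopingRHS : A → A → A → A
  telescopingRHS N K V =
    termNumerator (N + κ 3) K V * certificate N (1# + K) V - termDenominator N K * certificate N K V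

  bracketDenominator : A → A
  bracketDenominator N = (κ 3 * N + κ 1) * (κ 3 * N + κ 2)

  bracketNumerator : ℕ → A → A → A
  bracketNumerator j N U = (κ⁺ j + U + κ 3 * N) * (κ⁺ (3 ∸ j) - U + κ 3 * N)

  bracketRecurrenceCheck : ℕ → A → A → A
  bracketRecurrenceCheck j N U =
      recurrence₀ N V * (d N * d (1# + N) * d (1# + (1# + N)))
    + recurrence₁ N V * (u N * d (1# + N) * d (1# + (1# + N)))
    + recurrence₂ N V * (u N * u (1# + N) * d (1# + (1# + N)))
    + recurrence₃ N V * (u N * u (1# + N) * u (1# + (1# + N)))
    where
    V = U * (1# + U)
    d : A → A
    d = bracketDenominator
    u : A → A
    u M = bracketNumerator j M U

module FieldProperties {c ℓ : Level} (F : CharZeroField c ℓ) where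
  open CharZeroField F
  open IntegerCoefficientRingSolver commutativeRing using (ι-+; solve; _⊜_; ringSyntax)
  open RingSyntax ringSyntax using (∏<)
  open import Relation.Binary.Reasoning.Setoid setoid

  1≉0 : 1# ≉ 0#
  1≉0 1≈0 = charZero 0 (trans (+-identityʳ 1#) 1≈0)

  ⁻¹-inverseˡ : ∀ {x} → x ≉ 0# → x ⁻¹ * x ≈ 1#
  ⁻¹-inverseˡ {x} x≉0 = trans (*-comm _ _) (inverseʳ x x≉0)

  ≉0-resp-≈ : ∀ {x y} → x ≈ y → x ≉ 0# → y ≉ 0#
  ≉0-resp-≈ x≈y x≉0 y≈0 = x≉0 (trans x≈y y≈0)

  *-cancelˡ-≈0 : ∀ {x y} → x ≉ 0# → x * y ≈ 0# → y ≈ 0#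
  *-cancelˡ-≈0 {x} {y} x≉0 xy≈0 = begin
    y                ≈⟨ *-identityˡ y ⟨
    1# * y           ≈⟨ *-congʳ (⁻¹-inverseˡ x≉0) ⟨
    (x ⁻¹ * x) * y   ≈⟨ *-assoc _ _ _ ⟩
    x ⁻¹ * (x * y)   ≈⟨ *-congˡ xy≈0 ⟩
    x ⁻¹ * 0#        ≈⟨ zeroʳ _ ⟩
    0#               ∎

  *-≉0 : ∀ {x y} → x ≉ 0# → y ≉ 0# → x * y ≉ 0#
  *-≉0 x≉0 y≉0 xy≈0 = y≉0 (*-cancelˡ-≈0 x≉0 xy≈0)

  *-≉0ˡ : ∀ {x y} → x * y ≉ 0# → x ≉ 0#
  *-≉0ˡ {x} {y} xy≉0 x≈0 = xy≉0 (trans (*-congʳ x≈0) (zeroˡ y))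

  -‿≉0 : ∀ {x} → x ≉ 0# → - x ≉ 0#
  -‿≉0 {x} x≉0 -x≈0 = x≉0 (begin
    x      ≈⟨ solve 1 (λ x → x ⊜ ⊝ (⊝ x)) refl x ⟩
    - - x  ≈⟨ -‿cong -x≈0 ⟩
    - 0#   ≈⟨ solve 0 (⊝ Κ (+ 0) ⊜ Κ (+ 0)) refl ⟩
    0#     ∎)

  *-cancelʳ : ∀ {x y z} → z ≉ 0# → x * z ≈ y * z → x ≈ y
  *-cancelʳ {x} {y} {z} z≉0 xz≈yz = begin
    x            ≈⟨ solve 2 (λ x y → x ⊜ y ⊕ (x ⊕ ⊝ y)) refl x y ⟩
    y + (x - y)  ≈⟨ +-congˡ (*-cancelˡ-≈0 z≉0 z[x-y]≈0) ⟩
    y + 0#       ≈⟨ +-identityʳ y ⟩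
    y            ∎
    where
    z[x-y]≈0 : z * (x - y) ≈ 0#
    z[x-y]≈0 = begin
      z * (x - y)    ≈⟨ solve 3 (λ x y z → z ⊗ (x ⊕ ⊝ y) ⊜ x ⊗ z ⊕ ⊝ (y ⊗ z)) refl x y z ⟩
      x * z - y * z  ≈⟨ +-congʳ xz≈yz ⟩
      y * z - y * z  ≈⟨ -‿inverseʳ _ ⟩
      0#             ∎

  *-cancelˡ : ∀ {x y z} → z ≉ 0# → z * x ≈ z * y → x ≈ y
  *-cancelˡ {x} {y} {z} z≉0 zx≈zy = *-cancelʳ z≉0 (trans (*-comm x z) (trans zx≈zy (*-comm z y)))

  ⁻¹-cong : ∀ {x y} → x ≉ 0# → x ≈ y → x ⁻¹ ≈ y ⁻¹
  ⁻¹-cong {x} {y} x≉0 x≈y = *-cancelʳ x≉0 (begin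
    x ⁻¹ * x  ≈⟨ ⁻¹-inverseˡ x≉0 ⟩
    1#        ≈⟨ ⁻¹-inverseˡ (≉0-resp-≈ x≈y x≉0) ⟨
    y ⁻¹ * y  ≈⟨ *-congˡ x≈y ⟨
    y ⁻¹ * x  ∎)

  ⁻¹-distrib-* : ∀ {x y} → x ≉ 0# → y ≉ 0# → (x * y) ⁻¹ ≈ x ⁻¹ * y ⁻¹
  ⁻¹-distrib-* {x} {y} x≉0 y≉0 = *-cancelʳ (*-≉0 x≉0 y≉0) (begin
    (x * y) ⁻¹ * (x * y)     ≈⟨ ⁻¹-inverseˡ (*-≉0 x≉0 y≉0) ⟩
    1#                       ≈⟨ *-identityʳ 1# ⟨
    1# * 1#                  ≈⟨ *-cong (⁻¹-inverseˡ x≉0) (⁻¹-inverseˡ y≉0) ⟨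
    (x ⁻¹ * x) * (y ⁻¹ * y)  ≈⟨ solve 4 (λ x x′ y y′ → (x′ ⊗ x) ⊗ (y′ ⊗ y) ⊜ (x′ ⊗ y′) ⊗ (x ⊗ y)) refl x (x ⁻¹) y (y ⁻¹) ⟩
    (x ⁻¹ * y ⁻¹) * (x * y)  ∎)

  ÷-step : ∀ {X x X′ Y y Y′} → Y ≉ 0# → y ≉ 0# → X′ ≈ X * x → Y′ ≈ Y * y → (X′ ÷ Y′) * y ≈ (X ÷ Y) * x
  ÷-step {X} {x} {X′} {Y} {y} {Y′} Y≉0 y≉0 X′≈Xx Y′≈Yy = begin
    X′ * Y′ ⁻¹ * y             ≈⟨ *-congʳ (*-cong X′≈Xx (⁻¹-cong (≉0-resp-≈ (sym Y′≈Yy) (*-≉0 Y≉0 y≉0)) Y′≈Yy)) ⟩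
    X * x * (Y * y) ⁻¹ * y     ≈⟨ *-congʳ (*-congˡ (⁻¹-distrib-* Y≉0 y≉0)) ⟩
    X * x * (Y ⁻¹ * y ⁻¹) * y  ≈⟨ solve 5 (λ X x Y′ y′ y → X ⊗ x ⊗ (Y′ ⊗ y′) ⊗ y ⊜ X ⊗ Y′ ⊗ x ⊗ (y′ ⊗ y)) refl
                                    X x (Y ⁻¹) (y ⁻¹) y ⟩
    X * Y ⁻¹ * x * (y ⁻¹ * y)  ≈⟨ *-congˡ (⁻¹-inverseˡ y≉0) ⟩
    X * Y ⁻¹ * x * 1#          ≈⟨ *-identityʳ _ ⟩
    X * Y ⁻¹ * x               ∎

  ÷-≈1 : ∀ {X Y} → X ≈ 1# → Y ≈ 1# → X ÷ Y ≈ 1#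
  ÷-≈1 {X} {Y} X≈1 Y≈1 = begin
    X * Y ⁻¹    ≈⟨ *-cong X≈1 (⁻¹-cong (≉0-resp-≈ (sym Y≈1) 1≉0) Y≈1) ⟩
    1# * 1# ⁻¹  ≈⟨ inverseʳ 1# 1≉0 ⟩
    1#          ∎

  ≈-modulo : ∀ {X Y r W} → r ≈ 0# → X ≈ Y + r * W → X ≈ Y
  ≈-modulo {X} {Y} {r} {W} r≈0 X≈Y+rW = begin
    X          ≈⟨ X≈Y+rW ⟩
    Y + r * W  ≈⟨ +-congˡ (trans (*-congʳ r≈0) (zeroˡ W)) ⟩
    Y + 0#     ≈⟨ +-identityʳ Y ⟩
    Y          ∎

  fromℕ-≉0 : ∀ n → 0 < n → fromℕ n ≉ 0#
  fromℕ-≉0 (suc n) _ = charZero n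

  fromℕ-*⁻¹ : ∀ n → 0 < n → fromℕ n * fromℕ n ⁻¹ - 1# ≈ 0#
  fromℕ-*⁻¹ n 0<n = trans (+-congʳ (inverseʳ _ (fromℕ-≉0 n 0<n))) (-‿inverseʳ 1#)

  fromℕ-<⇒-≉0 : ∀ {m p} → m < p → fromℕ p - fromℕ m ≉ 0#
  fromℕ-<⇒-≉0 {m} {p} m<p = ≉0-resp-≈ (sym difference) (fromℕ-≉0 (p ∸ m) (N.m<n⇒0<n∸m m<p))
    where
    difference : fromℕ p - fromℕ m ≈ fromℕ (p ∸ m)
    difference = begin
      fromℕ p - fromℕ m                    ≡⟨ ≡.cong (λ q → fromℕ q - fromℕ m) (N.m+[n∸m]≡n (N.<⇒≤ m<p)) ⟨
      fromℕ (m N.+ (p ∸ m)) - fromℕ m      ≈⟨ +-congʳ (ι-+ m (p ∸ m)) ⟩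
      (fromℕ m + fromℕ (p ∸ m)) - fromℕ m  ≈⟨ solve 2 (λ a b → (a ⊕ b) ⊕ ⊝ a ⊜ b) refl (fromℕ m) (fromℕ (p ∸ m)) ⟩
      fromℕ (p ∸ m)                        ∎

  fromℕ-≢⇒-≉0 : ∀ {m p} → m ≢ p → fromℕ m - fromℕ p ≉ 0#
  fromℕ-≢⇒-≉0 {m} {p} m≢p with N.<-cmp m p
  ... | tri< m<p _ _ = ≉0-resp-≈ (solve 2 (λ a b → ⊝ (b ⊕ ⊝ a) ⊜ a ⊕ ⊝ b) refl (fromℕ m) (fromℕ p)) (-‿≉0 (fromℕ-<⇒-≉0 m<p))
  ... | tri≈ _ m≡p _ = contradiction m≡p m≢p
  ... | tri> _ _ p<m = fromℕ-<⇒-≉0 p<m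

  poch-≉0 : ∀ a k → (∀ i → i < k → a + fromℕ i ≉ 0#) → poch a k ≉ 0#
  poch-≉0 a zero    _       = 1≉0
  poch-≉0 a (suc k) a+i≉0 = *-≉0 (poch-≉0 a k (λ i i<k → a+i≉0 i (N.m<n⇒m<1+n i<k))) (a+i≉0 k N.≤-refl)

  poch-neg≈0 : ∀ {n k} → n < k → poch (- fromℕ n) k ≈ 0#
  poch-neg≈0 {n} {suc k} (s≤s n≤k) with N.m≤n⇒m<n∨m≡n n≤k
  ... | inj₁ n<k    = trans (*-congʳ (poch-neg≈0 n<k)) (zeroˡ _)
  ... | inj₂ ≡.refl = trans (*-congˡ (-‿inverseˡ (fromℕ n))) (zeroʳ _)

  ∏<-≉0 : ∀ k {f} → (∀ j → j < k → f j ≉ 0#) → ∏< k f ≉ 0#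
  ∏<-≉0 zero    _   = 1≉0
  ∏<-≉0 (suc k) f≉0 = *-≉0 (∏<-≉0 k (λ j j<k → f≉0 j (N.m<n⇒m<1+n j<k))) (f≉0 k N.≤-refl)

  ∏<-÷-ratio : ∀ {u d : ℕ → Carrier} k → d k ≉ 0# → ∏< (suc k) (λ j → u j ÷ d j) * d k ≈ ∏< k (λ j → u j ÷ d j) * u k
  ∏<-÷-ratio {u} {d} k dₖ≉0 = begin
    p * (u k * d k ⁻¹) * d k  ≈⟨ solve 4 (λ p u d′ d → p ⊗ (u ⊗ d′) ⊗ d ⊜ p ⊗ u ⊗ (d′ ⊗ d)) refl p (u k) (d k ⁻¹) (d k) ⟩
    p * u k * (d k ⁻¹ * d k)  ≈⟨ *-congˡ (⁻¹-inverseˡ dₖ≉0) ⟩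
    p * u k * 1#              ≈⟨ *-identityʳ _ ⟩
    p * u k                   ∎
    where p = ∏< k (λ j → u j ÷ d j)

module HypergeometricSequences {c ℓ : Level} (F : CharZeroField c ℓ) where
  open CharZeroField F
  open FieldProperties F
  open IntegerCoefficientRingSolver commutativeRing using (ι-*; solve; _⊜_; ringSyntax)
  open RingSyntax ringSyntax using (∏<; clearedSum)
  open import Relation.Binary.Reasoning.Setoid setoid

  hypergeometricTerm : (a b c d e z : Carrier) → ℕ → Carrier
  hypergeometricTerm a b c d e z k =
    ((poch a k * poch b k * poch c k) ÷ (fromℕ (k !) * poch d k * poch e k)) * pow z k

  hypergeometricTerm-zero : ∀ a b c d e z → hypergeometricTerm a b c d e z 0 ≈ 1#
  hypergeometricTerm-zero a b c d e z =
    trans (*-identityʳ _) (÷-≈1 (solve 0 (𝟙 ⊗ 𝟙 ⊗ 𝟙 ⊜ 𝟙) refl) (solve 0 (Κ (+ 1) ⊗ 𝟙 ⊗ 𝟙 ⊜ 𝟙) refl))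

  hypergeometricTerm-ratio : ∀ a b c d e z k → (∀ i → i < k → d + fromℕ i ≉ 0#) → (∀ i → i < k → e + fromℕ i ≉ 0#) →
    fromℕ (suc k) * (d + fromℕ k) * (e + fromℕ k) ≉ 0# →
    hypergeometricTerm a b c d e z (suc k) * (fromℕ (suc k) * (d + fromℕ k) * (e + fromℕ k))
      ≈ hypergeometricTerm a b c d e z k * ((a + fromℕ k) * (b + fromℕ k) * (c + fromℕ k) * z)
  hypergeometricTerm-ratio a b c d e z k d+i≉0 e+i≉0 β≉0 = begin
    X′ ÷ Y′ * (pow z k * z) * β      ≈⟨ solve 4 (λ q p z β → q ⊗ (p ⊗ z) ⊗ β ⊜ q ⊗ β ⊗ (p ⊗ z)) refl (X′ ÷ Y′) (pow z k) z β ⟩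
    X′ ÷ Y′ * β * (pow z k * z)      ≈⟨ *-congʳ (÷-step Y≉0 β≉0 X′≈Xα Y′≈Yβ) ⟩
    X ÷ Y * α * (pow z k * z)        ≈⟨ solve 4 (λ q α p z → q ⊗ α ⊗ (p ⊗ z) ⊜ q ⊗ p ⊗ (α ⊗ z)) refl (X ÷ Y) α (pow z k) z ⟩
    X ÷ Y * pow z k * (α * z)        ∎
    where
    K = fromℕ k
    X = poch a k * poch b k * poch c k
    Y = fromℕ (k !) * poch d k * poch e k
    X′ = poch a (suc k) * poch b (suc k) * poch c (suc k)
    Y′ = fromℕ (suc k !) * poch d (suc k) * poch e (suc k)
    α = (a + K) * (b + K) * (c + K)
    β = fromℕ (suc k) * (d + K) * (e + K)
    Y≉0 : Y ≉ 0#
    Y≉0 = *-≉0 (*-≉0 (fromℕ-≉0 (k !) (N.1≤n! k)) (poch-≉0 d k d+i≉0)) (poch-≉0 e k e+i≉0)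
    X′≈Xα : X′ ≈ X * α
    X′≈Xα = solve 6 (λ pa pb pc a b c → pa ⊗ a ⊗ (pb ⊗ b) ⊗ (pc ⊗ c) ⊜ pa ⊗ pb ⊗ pc ⊗ (a ⊗ b ⊗ c)) refl
              (poch a k) (poch b k) (poch c k) (a + K) (b + K) (c + K)
    Y′≈Yβ : Y′ ≈ Y * β
    Y′≈Yβ = begin
      fromℕ (suc k N.* k !) * (poch d k * (d + K)) * (poch e k * (e + K))
        ≈⟨ *-congʳ (*-congʳ (ι-* (suc k) (k !))) ⟩
      fromℕ (suc k) * fromℕ (k !) * (poch d k * (d + K)) * (poch e k * (e + K))
        ≈⟨ solve 6 (λ s f pd d pe e → s ⊗ f ⊗ (pd ⊗ d) ⊗ (pe ⊗ e) ⊜ f ⊗ pd ⊗ pe ⊗ (s ⊗ d ⊗ e)) refl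
             (fromℕ (suc k)) (fromℕ (k !)) (poch d k) (d + K) (poch e k) (e + K) ⟩
      Y * β ∎

  hypergeometricTerm-vanishes : ∀ a b d e z {n k} → n < k → hypergeometricTerm a b (- fromℕ n) d e z k ≈ 0#
  hypergeometricTerm-vanishes a b d e z {n} {k} n<k = begin
    poch a k * poch b k * poch (- fromℕ n) k * _ ⁻¹ * pow z k  ≈⟨ *-congʳ (*-congʳ (*-congˡ (poch-neg≈0 n<k))) ⟩
    poch a k * poch b k * 0# * _ ⁻¹ * pow z k
      ≈⟨ solve 4 (λ p q r s → p ⊗ q ⊗ Κ (+ 0) ⊗ r ⊗ s ⊜ Κ (+ 0)) refl (poch a k) (poch b k) _ (pow z k) ⟩
    0#                                                        ∎

  bracket-zero : ∀ a₁ a₂ b₁ b₂ → bracket a₁ a₂ b₁ b₂ 0 ≈ 1#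
  bracket-zero a₁ a₂ b₁ b₂ = ÷-≈1 (*-identityʳ 1#) (*-identityʳ 1#)

  bracket-ratio : ∀ a₁ a₂ b₁ b₂ m → poch b₁ m * poch b₂ m ≉ 0# → (b₁ + fromℕ m) * (b₂ + fromℕ m) ≉ 0# →
    bracket a₁ a₂ b₁ b₂ (suc m) * ((b₁ + fromℕ m) * (b₂ + fromℕ m)) ≈ bracket a₁ a₂ b₁ b₂ m * ((a₁ + fromℕ m) * (a₂ + fromℕ m))
  bracket-ratio a₁ a₂ b₁ b₂ m Y≉0 β≉0 = ÷-step Y≉0 β≉0 (rearrange a₁ a₂) (rearrange b₁ b₂)
    where
    rearrange : ∀ x y → poch x (suc m) * poch y (suc m) ≈ poch x m * poch y m * ((x + fromℕ m) * (y + fromℕ m))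
    rearrange x y = solve 4 (λ p x q y → p ⊗ x ⊗ (q ⊗ y) ⊜ p ⊗ q ⊗ (x ⊗ y)) refl (poch x m) (x + fromℕ m) (poch y m) (y + fromℕ m)

  hypergeometric-closedForm : ∀ {s d u : ℕ → Carrier} m → (∀ k → k < m → s (suc k) * d k ≈ s k * u k) →
                              s m * ∏< m d ≈ s 0 * ∏< m u
  hypergeometric-closedForm         zero    _     = refl
  hypergeometric-closedForm {s} {d} {u} (suc m) ratio = begin
    s (suc m) * (∏< m d * d m)    ≈⟨ solve 3 (λ s p d → s ⊗ (p ⊗ d) ⊜ s ⊗ d ⊗ p) refl (s (suc m)) (∏< m d) (d m) ⟩
    s (suc m) * d m * ∏< m d      ≈⟨ *-congʳ (ratio m N.≤-refl) ⟩
    s m * u m * ∏< m d            ≈⟨ solve 3 (λ s u p → s ⊗ u ⊗ p ⊜ s ⊗ p ⊗ u) refl (s m) (u m) (∏< m d) ⟩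
    s m * ∏< m d * u m            ≈⟨ *-congʳ (hypergeometric-closedForm m (λ k k<m → ratio k (N.m<n⇒m<1+n k<m))) ⟩
    s 0 * ∏< m u * u m            ≈⟨ *-assoc _ _ _ ⟩
    s 0 * (∏< m u * u m)          ∎

  sumTo-clearedSum : ∀ {s d u : ℕ → Carrier} m → s 0 ≈ 1# → (∀ k → k < m → s (suc k) * d k ≈ s k * u k) →
                     sumTo m s * ∏< m d ≈ clearedSum u d m
  sumTo-clearedSum         zero    s₀≈1 _     = trans (*-identityʳ _) s₀≈1
  sumTo-clearedSum {s} {d} {u} (suc m) s₀≈1 ratio = begin
    (sumTo m s + s (suc m)) * (∏< m d * d m)
      ≈⟨ solve 4 (λ σ s p d → (σ ⊕ s) ⊗ (p ⊗ d) ⊜ σ ⊗ p ⊗ d ⊕ s ⊗ (p ⊗ d)) refl (sumTo m s) (s (suc m)) (∏< m d) (d m) ⟩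
    sumTo m s * ∏< m d * d m + s (suc m) * ∏< (suc m) d
      ≈⟨ +-cong (*-congʳ (sumTo-clearedSum m s₀≈1 (λ k k<m → ratio k (N.m<n⇒m<1+n k<m))))
                (trans (hypergeometric-closedForm (suc m) ratio) (trans (*-congʳ s₀≈1) (*-identityˡ _))) ⟩
    clearedSum u d m * d m + ∏< (suc m) u ∎

  hypergeometric-proportional : ∀ {s σ d u δ ν P : ℕ → Carrier} {C} m →
    s 0 * C ≈ σ 0 * P 0 →
    (∀ k → k < m → s (suc k) * d k ≈ s k * u k) →
    (∀ k → k < m → σ (suc k) * δ k ≈ σ k * ν k) →
    (∀ k → ν k * P (suc k) * d k ≈ P k * u k * δ k) →
    (∀ k → k < m → d k * δ k ≉ 0#) →
    s m * C ≈ σ m * P m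
  hypergeometric-proportional zero start _ _ _ _ = start
  hypergeometric-proportional {s} {σ} {d} {u} {δ} {ν} {P} {C} (suc m) start sRatio σRatio PRatio dδ≉0 =
    *-cancelʳ (dδ≉0 m N.≤-refl) (begin
      s (suc m) * C * (d m * δ m)
        ≈⟨ solve 4 (λ s c d δ → s ⊗ c ⊗ (d ⊗ δ) ⊜ s ⊗ d ⊗ (c ⊗ δ)) refl (s (suc m)) C (d m) (δ m) ⟩
      s (suc m) * d m * (C * δ m)        ≈⟨ *-congʳ (sRatio m N.≤-refl) ⟩
      s m * u m * (C * δ m)              ≈⟨ solve 4 (λ s u c δ → s ⊗ u ⊗ (c ⊗ δ) ⊜ s ⊗ c ⊗ (u ⊗ δ)) refl (s m) (u m) C (δ m) ⟩
      s m * C * (u m * δ m)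
        ≈⟨ *-congʳ (hypergeometric-proportional m start (below sRatio) (below σRatio) PRatio (below dδ≉0)) ⟩
      σ m * P m * (u m * δ m)
        ≈⟨ solve 4 (λ σ p u δ → σ ⊗ p ⊗ (u ⊗ δ) ⊜ σ ⊗ (p ⊗ u ⊗ δ)) refl (σ m) (P m) (u m) (δ m) ⟩
      σ m * (P m * u m * δ m)            ≈⟨ *-congˡ (PRatio m) ⟨
      σ m * (ν m * P (suc m) * d m)
        ≈⟨ solve 4 (λ σ ν p d → σ ⊗ (ν ⊗ p ⊗ d) ⊜ σ ⊗ ν ⊗ (p ⊗ d)) refl (σ m) (ν m) (P (suc m)) (d m) ⟩
      σ m * ν m * (P (suc m) * d m)      ≈⟨ *-congʳ (σRatio m N.≤-refl) ⟨
      σ (suc m) * δ m * (P (suc m) * d m)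
        ≈⟨ solve 4 (λ σ δ p d → σ ⊗ δ ⊗ (p ⊗ d) ⊜ σ ⊗ p ⊗ (d ⊗ δ)) refl (σ (suc m)) (δ m) (P (suc m)) (d m) ⟩
      σ (suc m) * P (suc m) * (d m * δ m) ∎)
    where
    below : ∀ {Q : ℕ → Set ℓ} → (∀ k → k < suc m → Q k) → ∀ k → k < m → Q k
    below h k k<m = h k (N.m<n⇒m<1+n k<m)

  sumTo-cong : ∀ m {f g : ℕ → Carrier} → (∀ k → k ≤ m → f k ≈ g k) → sumTo m f ≈ sumTo m g
  sumTo-cong zero    f≈g = f≈g 0 z≤n
  sumTo-cong (suc m) f≈g = +-cong (sumTo-cong m (λ k k≤m → f≈g k (N.m≤n⇒m≤1+n k≤m))) (f≈g (suc m) N.≤-refl)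

  sumTo-telescope : ∀ m (G : ℕ → Carrier) → sumTo m (λ k → G (suc k) - G k) ≈ G (suc m) - G 0
  sumTo-telescope zero    G = refl
  sumTo-telescope (suc m) G = trans (+-congʳ (sumTo-telescope m G))
    (solve 3 (λ a b c → (b ⊕ ⊝ c) ⊕ (a ⊕ ⊝ b) ⊜ a ⊕ ⊝ c) refl (G (suc (suc m))) (G (suc m)) (G 0))

  sumTo-extend : ∀ {m} {f : ℕ → Carrier} p → m ≤ p → (∀ k → m < k → f k ≈ 0#) → sumTo p f ≈ sumTo m f
  sumTo-extend {m} {f} p m≤p f≈0 with N.m≤n⇒m<n∨m≡n m≤p
  ... | inj₂ ≡.refl = refl
  sumTo-extend {m} {f} (suc p) m≤p f≈0 | inj₁ (s≤s m≤p′) = begin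
    sumTo p f + f (suc p)  ≈⟨ +-cong (sumTo-extend p m≤p′ f≈0) (f≈0 (suc p) (s≤s m≤p′)) ⟩
    sumTo m f + 0#         ≈⟨ +-identityʳ _ ⟩
    sumTo m f              ∎

  record Recurrence₃ : Set c where
    field
      coefficient₀ coefficient₁ coefficient₂ coefficient₃ : ℕ → Carrier

  open Recurrence₃

  apply : Recurrence₃ → (ℕ → Carrier) → ℕ → Carrier
  apply L f n =
    coefficient₀ L n * f n + coefficient₁ L n * f (1 N.+ n) + coefficient₂ L n * f (2 N.+ n) + coefficient₃ L n * f (3 N.+ n)

  scale : (ℕ → Carrier) → Recurrence₃ → Recurrence₃
  scale g L = record
    { coefficient₀ = λ n → coefficient₀ L n * g n
    ; coefficient₁ = λ n → coefficient₁ L n * g n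
    ; coefficient₂ = λ n → coefficient₂ L n * g n
    ; coefficient₃ = λ n → coefficient₃ L n * g n
    }

  apply-scale : ∀ g L f n → apply (scale g L) f n ≈ g n * apply L f n
  apply-scale g L f n =
    solve 9 (λ a b c d g x y z w → a ⊗ g ⊗ x ⊕ b ⊗ g ⊗ y ⊕ c ⊗ g ⊗ z ⊕ d ⊗ g ⊗ w ⊜ g ⊗ (a ⊗ x ⊕ b ⊗ y ⊕ c ⊗ z ⊕ d ⊗ w)) refl
      (coefficient₀ L n) (coefficient₁ L n) (coefficient₂ L n) (coefficient₃ L n)
      (g n) (f n) (f (1 N.+ n)) (f (2 N.+ n)) (f (3 N.+ n))

  apply-cong : ∀ L {f g} n → (∀ i → i ≤ 3 → f (i N.+ n) ≈ g (i N.+ n)) → apply L f n ≈ apply L g n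
  apply-cong L n f≈g = +-cong (+-cong (+-cong (*-congˡ (f≈g 0 z≤n)) (*-congˡ (f≈g 1 (s≤s z≤n))))
                                      (*-congˡ (f≈g 2 (s≤s (s≤s z≤n))))) (*-congˡ (f≈g 3 N.≤-refl))

  apply-sumTo : ∀ L (f : ℕ → ℕ → Carrier) m n →
                sumTo m (λ k → apply L (λ n′ → f n′ k) n) ≈ apply L (λ n′ → sumTo m (f n′)) n
  apply-sumTo L f zero    n = refl
  apply-sumTo L f (suc m) n = trans (+-congʳ (apply-sumTo L f m n))
    (solve 12 (λ a b c d x y z w x′ y′ z′ w′ →
                 (a ⊗ x ⊕ b ⊗ y ⊕ c ⊗ z ⊕ d ⊗ w) ⊕ (a ⊗ x′ ⊕ b ⊗ y′ ⊕ c ⊗ z′ ⊕ d ⊗ w′)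
               ⊜ a ⊗ (x ⊕ x′) ⊕ b ⊗ (y ⊕ y′) ⊕ c ⊗ (z ⊕ z′) ⊕ d ⊗ (w ⊕ w′)) refl
       (coefficient₀ L n) (coefficient₁ L n) (coefficient₂ L n) (coefficient₃ L n)
       (sumTo m (f n)) (sumTo m (f (1 N.+ n))) (sumTo m (f (2 N.+ n))) (sumTo m (f (3 N.+ n)))
       (f n (suc m)) (f (1 N.+ n) (suc m)) (f (2 N.+ n) (suc m)) (f (3 N.+ n) (suc m)))

  annihilates-+ : ∀ L {f g} → (∀ n → apply L f n ≈ 0#) → (∀ n → apply L g n ≈ 0#) →
                  ∀ n → apply L (λ m → f m + g m) n ≈ 0#
  annihilates-+ L {f} {g} Lf≈0 Lg≈0 n = begin
    apply L (λ m → f m + g m) n  ≈⟨ solve 12 (λ a b c d x y z w x′ y′ z′ w′ →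
                                          a ⊗ (x ⊕ x′) ⊕ b ⊗ (y ⊕ y′) ⊕ c ⊗ (z ⊕ z′) ⊕ d ⊗ (w ⊕ w′)
                                        ⊜ (a ⊗ x ⊕ b ⊗ y ⊕ c ⊗ z ⊕ d ⊗ w) ⊕ (a ⊗ x′ ⊕ b ⊗ y′ ⊕ c ⊗ z′ ⊕ d ⊗ w′)) refl
                                      (coefficient₀ L n) (coefficient₁ L n) (coefficient₂ L n) (coefficient₃ L n)
                                      (f n) (f (1 N.+ n)) (f (2 N.+ n)) (f (3 N.+ n))
                                      (g n) (g (1 N.+ n)) (g (2 N.+ n)) (g (3 N.+ n)) ⟩
    apply L f n + apply L g n    ≈⟨ +-cong (Lf≈0 n) (Lg≈0 n) ⟩
    0# + 0#                      ≈⟨ +-identityʳ 0# ⟩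
    0#                           ∎

  annihilates-*ˡ : ∀ L {f} a → (∀ n → apply L f n ≈ 0#) → ∀ n → apply L (λ m → a * f m) n ≈ 0#
  annihilates-*ˡ L {f} a Lf≈0 n = begin
    apply L (λ m → a * f m) n  ≈⟨ solve 9 (λ a₀ a₁ a₂ a₃ a x y z w → a₀ ⊗ (a ⊗ x) ⊕ a₁ ⊗ (a ⊗ y) ⊕ a₂ ⊗ (a ⊗ z) ⊕ a₃ ⊗ (a ⊗ w)
                                        ⊜ a ⊗ (a₀ ⊗ x ⊕ a₁ ⊗ y ⊕ a₂ ⊗ z ⊕ a₃ ⊗ w)) refl
                                    (coefficient₀ L n) (coefficient₁ L n) (coefficient₂ L n) (coefficient₃ L n)
                                    a (f n) (f (1 N.+ n)) (f (2 N.+ n)) (f (3 N.+ n)) ⟩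
    a * apply L f n            ≈⟨ *-congˡ (Lf≈0 n) ⟩
    a * 0#                     ≈⟨ zeroʳ a ⟩
    0#                         ∎

  annihilates-neg : ∀ L {f} → (∀ n → apply L f n ≈ 0#) → ∀ n → apply L (λ m → - f m) n ≈ 0#
  annihilates-neg L {f} Lf≈0 n = begin
    apply L (λ m → - f m) n  ≈⟨ solve 8 (λ a₀ a₁ a₂ a₃ x y z w → a₀ ⊗ (⊝ x) ⊕ a₁ ⊗ (⊝ y) ⊕ a₂ ⊗ (⊝ z) ⊕ a₃ ⊗ (⊝ w)
                                      ⊜ ⊝ (a₀ ⊗ x ⊕ a₁ ⊗ y ⊕ a₂ ⊗ z ⊕ a₃ ⊗ w)) refl
                                  (coefficient₀ L n) (coefficient₁ L n) (coefficient₂ L n) (coefficient₃ L n)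
                                  (f n) (f (1 N.+ n)) (f (2 N.+ n)) (f (3 N.+ n)) ⟩
    - apply L f n            ≈⟨ -‿cong (Lf≈0 n) ⟩
    - 0#                     ≈⟨ solve 0 (⊝ Κ (+ 0) ⊜ Κ (+ 0)) refl ⟩
    0#                       ∎

  hypergeometric-annihilated : ∀ L {B d u : ℕ → Carrier} n →
    (∀ m → B (suc m) * d m ≈ B m * u m) → (∀ m → d m ≉ 0#) →
    coefficient₀ L n * (d n * d (1 N.+ n) * d (2 N.+ n)) + coefficient₁ L n * (u n * d (1 N.+ n) * d (2 N.+ n))
      + coefficient₂ L n * (u n * u (1 N.+ n) * d (2 N.+ n)) + coefficient₃ L n * (u n * u (1 N.+ n) * u (2 N.+ n)) ≈ 0# →
    apply L B n ≈ 0#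
  hypergeometric-annihilated L {B} {d} {u} n ratio d≉0 check≈0 =
    *-cancelʳ D≉0 (trans (begin
      apply L B n * D
        ≈⟨ solve 11 (λ a₀ a₁ a₂ a₃ b₀ b₁ b₂ b₃ d₀ d₁ d₂ →
                       (a₀ ⊗ b₀ ⊕ a₁ ⊗ b₁ ⊕ a₂ ⊗ b₂ ⊕ a₃ ⊗ b₃) ⊗ (𝟙 ⊗ d₀ ⊗ d₁ ⊗ d₂)
                     ⊜ a₀ ⊗ b₀ ⊗ (d₀ ⊗ d₁ ⊗ d₂) ⊕ a₁ ⊗ (b₁ ⊗ (𝟙 ⊗ d₀)) ⊗ (d₁ ⊗ d₂)
                       ⊕ a₂ ⊗ (b₂ ⊗ (𝟙 ⊗ d₀ ⊗ d₁)) ⊗ d₂ ⊕ a₃ ⊗ (b₃ ⊗ (𝟙 ⊗ d₀ ⊗ d₁ ⊗ d₂))) refl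
             a₀ a₁ a₂ a₃ (B n) (B (1 N.+ n)) (B (2 N.+ n)) (B (3 N.+ n)) (d n) (d (1 N.+ n)) (d (2 N.+ n)) ⟩
      a₀ * B n * (d n * d (1 N.+ n) * d (2 N.+ n)) + a₁ * (B (1 N.+ n) * ∏< 1 dₙ) * (d (1 N.+ n) * d (2 N.+ n))
        + a₂ * (B (2 N.+ n) * ∏< 2 dₙ) * d (2 N.+ n) + a₃ * (B (3 N.+ n) * ∏< 3 dₙ)
        ≈⟨ +-cong (+-cong (+-congˡ (*-congʳ (*-congˡ (closedForm 1)))) (*-congʳ (*-congˡ (closedForm 2))))
                  (*-congˡ (closedForm 3)) ⟩
      a₀ * B n * (d n * d (1 N.+ n) * d (2 N.+ n)) + a₁ * (B n * ∏< 1 uₙ) * (d (1 N.+ n) * d (2 N.+ n))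
        + a₂ * (B n * ∏< 2 uₙ) * d (2 N.+ n) + a₃ * (B n * ∏< 3 uₙ)
        ≈⟨ solve 11 (λ a₀ a₁ a₂ a₃ b d₀ d₁ d₂ u₀ u₁ u₂ →
                       a₀ ⊗ b ⊗ (d₀ ⊗ d₁ ⊗ d₂) ⊕ a₁ ⊗ (b ⊗ (𝟙 ⊗ u₀)) ⊗ (d₁ ⊗ d₂)
                       ⊕ a₂ ⊗ (b ⊗ (𝟙 ⊗ u₀ ⊗ u₁)) ⊗ d₂ ⊕ a₃ ⊗ (b ⊗ (𝟙 ⊗ u₀ ⊗ u₁ ⊗ u₂))
                     ⊜ b ⊗ (a₀ ⊗ (d₀ ⊗ d₁ ⊗ d₂) ⊕ a₁ ⊗ (u₀ ⊗ d₁ ⊗ d₂) ⊕ a₂ ⊗ (u₀ ⊗ u₁ ⊗ d₂) ⊕ a₃ ⊗ (u₀ ⊗ u₁ ⊗ u₂))) refl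
             a₀ a₁ a₂ a₃ (B n) (d n) (d (1 N.+ n)) (d (2 N.+ n)) (u n) (u (1 N.+ n)) (u (2 N.+ n)) ⟩
      B n * _   ≈⟨ *-congˡ check≈0 ⟩
      B n * 0#  ≈⟨ zeroʳ _ ⟩
      0#        ∎) (sym (zeroˡ D)))
    where
    a₀ = coefficient₀ L n
    a₁ = coefficient₁ L n
    a₂ = coefficient₂ L n
    a₃ = coefficient₃ L n
    dₙ uₙ : ℕ → Carrier
    dₙ k = d (k N.+ n)
    uₙ k = u (k N.+ n)
    D = ∏< 3 dₙ
    D≉0 : D ≉ 0#
    D≉0 = ∏<-≉0 3 (λ k _ → d≉0 (k N.+ n))
    closedForm : ∀ m → B (m N.+ n) * ∏< m dₙ ≈ B n * ∏< m uₙ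
    closedForm m = hypergeometric-closedForm m (λ k _ → ratio (k N.+ n))

  recurrence-uniqueness : ∀ L n₀ {f g : ℕ → Carrier} → (∀ n → n₀ ≤ n → coefficient₃ L n ≉ 0#) →
    (∀ n → n₀ ≤ n → apply L f n ≈ 0#) → (∀ n → n₀ ≤ n → apply L g n ≈ 0#) →
    (∀ m → m < 3 N.+ n₀ → f m ≈ g m) → ∀ m → f m ≈ g m
  recurrence-uniqueness L n₀ {f} {g} a₃≉0 Lf≈0 Lg≈0 initial = <-rec _ step
    where
    firstTerms : (ℕ → Carrier) → ℕ → Carrier
    firstTerms h n = coefficient₀ L n * h n + coefficient₁ L n * h (1 N.+ n) + coefficient₂ L n * h (2 N.+ n)

    lastTerm : ∀ h n → apply L h n ≈ 0# → coefficient₃ L n * h (3 N.+ n) ≈ - firstTerms h n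
    lastTerm h n Lh≈0 = begin
      t                      ≈⟨ solve 2 (λ s t → t ⊜ (s ⊕ t) ⊕ ⊝ s) refl (firstTerms h n) t ⟩
      apply L h n - firstTerms h n  ≈⟨ +-congʳ Lh≈0 ⟩
      0# - firstTerms h n    ≈⟨ +-identityˡ _ ⟩
      - firstTerms h n       ∎
      where t = coefficient₃ L n * h (3 N.+ n)

    step : ∀ m → (∀ {k} → k < m → f k ≈ g k) → f m ≈ g m
    step m earlier with m N.<? 3 N.+ n₀
    ... | yes m<3+n₀ = initial m m<3+n₀
    ... | no  m≮3+n₀ = ≡.subst (λ q → f q ≈ g q) (N.m+[n∸m]≡n 3≤m) (*-cancelˡ (a₃≉0 n n₀≤n) (begin
      coefficient₃ L n * f (3 N.+ n)  ≈⟨ lastTerm f n (Lf≈0 n n₀≤n) ⟩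
      - firstTerms f n
        ≈⟨ -‿cong (+-cong (+-cong (*-congˡ (earlier′ 0 (s≤s z≤n))) (*-congˡ (earlier′ 1 (s≤s (s≤s z≤n)))))
                          (*-congˡ (earlier′ 2 N.≤-refl))) ⟩
      - firstTerms g n                ≈⟨ lastTerm g n (Lg≈0 n n₀≤n) ⟨
      coefficient₃ L n * g (3 N.+ n)  ∎))
      where
      3+n₀≤m : 3 N.+ n₀ ≤ m
      3+n₀≤m = N.≮⇒≥ m≮3+n₀
      3≤m : 3 ≤ m
      3≤m = N.≤-trans (N.m≤m+n 3 n₀) 3+n₀≤m
      n = m ∸ 3
      n₀≤n : n₀ ≤ n
      n₀≤n = N.≤-trans (N.≤-reflexive (≡.sym (N.m+n∸m≡n 3 n₀))) (N.∸-monoˡ-≤ 3 3+n₀≤m)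
      earlier′ : ∀ i → i < 3 → f (i N.+ n) ≈ g (i N.+ n)
      earlier′ i i<3 = earlier (≡.subst (i N.+ n <_) (N.m+[n∸m]≡n 3≤m) (N.+-monoˡ-< n i<3))

module Corollary14 {c ℓ : Level} (F : CharZeroField c ℓ) (x : CharZeroField.Carrier F) where
  open CharZeroField F
  open FieldProperties F
  open HypergeometricSequences F
  open Recurrence₃
  open IntegerCoefficientRingSolver commutativeRing using (ι-+; ι-*; solve; _⊜_; ringSyntax)
  open RingSyntax ringSyntax using (∏<; clearedSum)
  module P = Certificate ringSyntax
  module E {m} = Certificate (exprSyntax {m})
  module ES {m} = RingSyntax (exprSyntax {m})
  open import Relation.Binary.Reasoning.Setoid setoid

  U V : Carrier
  U = fromℕ 3 * x
  V = U * (1# + U)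

  odd≉0 : ∀ k → fromℕ 2 * fromℕ k - 1# ≉ 0#
  odd≉0 k = ≉0-resp-≈ (+-cong (ι-* 2 k) (-‿cong (+-identityʳ 1#))) (fromℕ-≢⇒-≉0 (2k≢1 k))
    where
    2k≢1 : ∀ k → 2 N.* k ≢ 1
    2k≢1 (suc k) 2k+2≡1 = N.m+1+n≢0 k (N.suc-injective 2k+2≡1)

  3n+l≉0 : ∀ n l → 0 < l → fromℕ 3 * fromℕ n + fromℕ l ≉ 0#
  3n+l≉0 n l 0<l = ≉0-resp-≈ (trans (ι-+ (3 N.* n) l) (+-congʳ (ι-* 3 n)))
                             (fromℕ-≉0 (3 N.* n N.+ l) (N.<-≤-trans 0<l (N.m≤n+m l (3 N.* n))))

  k-3n≉0 : ∀ n k → k ≢ 3 N.* n → fromℕ k - fromℕ 3 * fromℕ n ≉ 0#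
  k-3n≉0 n k k≢3n = ≉0-resp-≈ (+-congˡ (-‿cong (ι-* 3 n))) (fromℕ-≢⇒-≉0 k≢3n)

  3+n<3n : ∀ n → 2 ≤ n → 3 N.+ n < 3 N.* n
  3+n<3n (suc (suc m)) _ = ≡.subst (6 N.+ m ≤_) (≡.sym (N.*-distribˡ-+ 3 2 m)) (N.+-monoʳ-≤ 6 (N.m≤n*m m 3))
  3+n<3n (suc zero) (s≤s ())

  numerator denominator : ℕ → ℕ → Carrier
  numerator   n k = P.termNumerator (fromℕ n) (fromℕ k) V
  denominator n k = P.termDenominator (fromℕ n) (fromℕ k)

  denominator≉0 : ∀ n k → k ≢ 3 N.* n → denominator n k ≉ 0#
  denominator≉0 n k k≢3n = ≉0-resp-≈ (sym factorised)
    (*-≉0 (*-≉0 (*-≉0 (fromℕ-≉0 4 (s≤s z≤n)) (fromℕ-≉0 (suc k) (s≤s z≤n))) (odd≉0 k)) (k-3n≉0 n k k≢3n))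
    where
    factorised : denominator n k ≈ fromℕ 4 * fromℕ (suc k) * (fromℕ 2 * fromℕ k - 1#) * (fromℕ k - fromℕ 3 * fromℕ n)
    factorised = solve 2 (λ N K → E.termDenominator N K ⊜ Κ (+ 4) ⊗ (𝟙 ⊕ K) ⊗ (Κ (+ 2) ⊗ K ⊕ ⊝ 𝟙) ⊗ (K ⊕ ⊝ (Κ (+ 3) ⊗ N)))
                         refl (fromℕ n) (fromℕ k)

  a b d z : Carrier
  a = fromℕ 3 * x
  b = - 1# - fromℕ 3 * x
  d = - (1# ÷ fromℕ 2)
  z = fromℕ 3 ÷ fromℕ 4

  e : ℕ → Carrier
  e n = - fromℕ (3 N.* n)

  term : ℕ → ℕ → Carrier
  term n = hypergeometricTerm a b (- fromℕ n) d (e n) z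

  d+i≉0 : ∀ i → d + fromℕ i ≉ 0#
  d+i≉0 i = *-≉0ˡ (≉0-resp-≈ (sym doubled) (odd≉0 i))
    where
    doubled : (d + fromℕ i) * fromℕ 2 ≈ fromℕ 2 * fromℕ i - 1#
    doubled = ≈-modulo (fromℕ-*⁻¹ 2 (s≤s z≤n))
      (solve 2 (λ h I → (⊝ (𝟙 ⊗ h) ⊕ I) ⊗ Κ (+ 2) ⊜ (Κ (+ 2) ⊗ I ⊕ ⊝ 𝟙) ⊕ (Κ (+ 2) ⊗ h ⊕ ⊝ 𝟙) ⊗ ⊝ 𝟙)
               refl (fromℕ 2 ⁻¹) (fromℕ i))

  e+i≉0 : ∀ n i → i < 3 N.* n → e n + fromℕ i ≉ 0#
  e+i≉0 n i i<3n = ≉0-resp-≈ (+-comm _ _) (fromℕ-≢⇒-≉0 (N.<⇒≢ i<3n))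

  term-ratio : ∀ n k → k < 3 N.* n → term n (suc k) * denominator n k ≈ term n k * numerator n k
  term-ratio n k k<3n = begin
    term n (suc k) * denominator n k  ≈⟨ *-congˡ β8≈denominator ⟨
    term n (suc k) * (β * fromℕ 8)    ≈⟨ *-assoc _ _ _ ⟨
    term n (suc k) * β * fromℕ 8
      ≈⟨ *-congʳ (hypergeometricTerm-ratio a b (- fromℕ n) d (e n) z k
                    (λ i _ → d+i≉0 i) (λ i i<k → e+i≉0 n i (N.<-trans i<k k<3n)) β≉0) ⟩
    term n k * (α * z) * fromℕ 8      ≈⟨ *-assoc _ _ _ ⟩
    term n k * (α * z * fromℕ 8)      ≈⟨ *-congˡ αz8≈numerator ⟩
    term n k * numerator n k          ∎
    where
    K = fromℕ k
    α = (a + K) * (b + K) * (- fromℕ n + K)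
    β = fromℕ (suc k) * (d + K) * (e n + K)
    β≉0 : β ≉ 0#
    β≉0 = *-≉0 (*-≉0 (fromℕ-≉0 (suc k) (s≤s z≤n)) (d+i≉0 k)) (e+i≉0 n k k<3n)
    -- Both conversions clear the denominators 2 and 4 of d and z, modulo 2 · 2⁻¹ = 1 and 4 · 4⁻¹ = 1.
    β8≈denominator : β * fromℕ 8 ≈ denominator n k
    β8≈denominator = begin
      fromℕ (suc k) * (d + K) * (- fromℕ (3 N.* n) + K) * fromℕ 8
        ≈⟨ *-congʳ (*-congˡ (+-congʳ (-‿cong (ι-* 3 n)))) ⟩
      fromℕ (suc k) * (d + K) * (- (fromℕ 3 * fromℕ n) + K) * fromℕ 8
        ≈⟨ ≈-modulo (fromℕ-*⁻¹ 2 (s≤s z≤n))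
             (solve 3 (λ h N K → (𝟙 ⊕ K) ⊗ (⊝ (𝟙 ⊗ h) ⊕ K) ⊗ (⊝ (Κ (+ 3) ⊗ N) ⊕ K) ⊗ Κ (+ 8)
                               ⊜ E.termDenominator N K ⊕ (Κ (+ 2) ⊗ h ⊕ ⊝ 𝟙) ⊗ ⊝ (Κ (+ 4) ⊗ (𝟙 ⊕ K) ⊗ (K ⊕ ⊝ (Κ (+ 3) ⊗ N))))
                    refl (fromℕ 2 ⁻¹) (fromℕ n) K) ⟩
      denominator n k ∎
    αz8≈numerator : α * z * fromℕ 8 ≈ numerator n k
    αz8≈numerator = ≈-modulo (fromℕ-*⁻¹ 4 (s≤s z≤n))
      (solve 4 (λ q X N K → (Κ (+ 3) ⊗ X ⊕ K) ⊗ (⊝ 𝟙 ⊕ ⊝ (Κ (+ 3) ⊗ X) ⊕ K) ⊗ (⊝ N ⊕ K) ⊗ (Κ (+ 3) ⊗ q) ⊗ Κ (+ 8)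
                       ⊜ E.termNumerator N K ((Κ (+ 3) ⊗ X) ⊗ (𝟙 ⊕ Κ (+ 3) ⊗ X))
                         ⊕ (Κ (+ 4) ⊗ q ⊕ ⊝ 𝟙) ⊗ (Κ (+ 6) ⊗ (Κ (+ 3) ⊗ X ⊕ K) ⊗ (⊝ 𝟙 ⊕ ⊝ (Κ (+ 3) ⊗ X) ⊕ K) ⊗ (⊝ N ⊕ K)))
         refl (fromℕ 4 ⁻¹) x (fromℕ n) K)

  term-vanishes : ∀ n k → n < k → term n k ≈ 0#
  term-vanishes n k = hypergeometricTerm-vanishes a b d (e n) z

  τNumerator : ℕ → ℕ → Carrier
  τNumerator n k = P.termNumerator (fromℕ n + fromℕ 3) (fromℕ k) V

  -- τ n takes the numerator of its ratio from term (3 + n) and the denominator from term n; each of the four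
  -- summands term (i + n) is a rational multiple of it (term-shift).
  τ : ℕ → ℕ → Carrier
  τ n k = ∏< k (λ j → τNumerator n j ÷ denominator n j)

  τ-ratio : ∀ n k → k ≢ 3 N.* n → τ n (suc k) * denominator n k ≈ τ n k * τNumerator n k
  τ-ratio n k k≢3n = ∏<-÷-ratio k (denominator≉0 n k k≢3n)

  τ-vanishes : ∀ n → τ n (4 N.+ n) ≈ 0#
  τ-vanishes n = begin
    τ n (3 N.+ n) * (τNumerator n (3 N.+ n) * denominator n (3 N.+ n) ⁻¹)  ≈⟨ *-congˡ (*-congʳ numerator≈0) ⟩
    τ n (3 N.+ n) * (0# * denominator n (3 N.+ n) ⁻¹)                      ≈⟨ *-congˡ (zeroˡ _) ⟩
    τ n (3 N.+ n) * 0#                                                      ≈⟨ zeroʳ _ ⟩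
    0#                                                                      ∎
    where
    numerator≈0 : τNumerator n (3 N.+ n) ≈ 0#
    numerator≈0 = solve 2 (λ N V → E.termNumerator (N ⊕ Κ (+ 3)) (ES.shift 3 N) V ⊜ Κ (+ 0)) refl (fromℕ n) V

  shiftFactor : ℕ → ℕ → ℕ → Carrier
  shiftFactor i n k = P.shiftFactor i (fromℕ n) (fromℕ k)

  shiftFactorRatioIdentity : ℕ → Expr ℤ 3 → Expr ℤ 3 → Expr ℤ 3 → Expr ℤ 3 × Expr ℤ 3
  shiftFactorRatioIdentity i N K V =
      E.termNumerator (N ⊕ Κ (+ 3)) K V ⊗ E.shiftFactor i N (𝟙 ⊕ K) ⊗ E.termDenominator (ES.shift i N) K
    ⊜ E.shiftFactor i N K ⊗ E.termNumerator (ES.shift i N) K V ⊗ E.termDenominator N K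

  -- The ratios of term (i + n) and of τ n differ by the factor shiftFactor i n (k + 1) / shiftFactor i n k.
  shiftFactor-ratio : ∀ i → i ≤ 3 → ∀ n k →
    τNumerator n k * shiftFactor i n (suc k) * denominator (i N.+ n) k
      ≈ shiftFactor i n k * numerator (i N.+ n) k * denominator n k
  shiftFactor-ratio 0 _ n k = solve 3 (shiftFactorRatioIdentity 0) refl (fromℕ n) (fromℕ k) V
  shiftFactor-ratio 1 _ n k = solve 3 (shiftFactorRatioIdentity 1) refl (fromℕ n) (fromℕ k) V
  shiftFactor-ratio 2 _ n k = solve 3 (shiftFactorRatioIdentity 2) refl (fromℕ n) (fromℕ k) V
  shiftFactor-ratio 3 _ n k = solve 3 (shiftFactorRatioIdentity 3) refl (fromℕ n) (fromℕ k) V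
  shiftFactor-ratio (suc (suc (suc (suc _)))) (s≤s (s≤s (s≤s ())))

  term-shift : ∀ i → i ≤ 3 → ∀ n → 2 ≤ n → ∀ k → k ≤ 3 N.+ n →
               term (i N.+ n) k * shiftFactor i n 0 ≈ τ n k * shiftFactor i n k
  term-shift i i≤3 n 2≤n k k≤3+n = hypergeometric-proportional k
    (*-congʳ (hypergeometricTerm-zero a b (- fromℕ (i N.+ n)) d (e (i N.+ n)) z))
    (λ j j<k → term-ratio (i N.+ n) j (j<3[i+n] j j<k))
    (λ j j<k → τ-ratio n j (N.<⇒≢ (j<3n j j<k)))
    (shiftFactor-ratio i i≤3 n)
    (λ j j<k → *-≉0 (denominator≉0 (i N.+ n) j (N.<⇒≢ (j<3[i+n] j j<k))) (denominator≉0 n j (N.<⇒≢ (j<3n j j<k))))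
    where
    j<3n : ∀ j → j < k → j < 3 N.* n
    j<3n j j<k = N.<-trans (N.<-≤-trans j<k k≤3+n) (3+n<3n n 2≤n)
    j<3[i+n] : ∀ j → j < k → j < 3 N.* (i N.+ n)
    j<3[i+n] j j<k = N.<-≤-trans (j<3n j j<k) (N.*-monoʳ-≤ 3 (N.m≤n+m n i))

  complementFactorIdentity : ℕ → Expr ℤ 1 → Expr ℤ 1 × Expr ℤ 1
  complementFactorIdentity i N = E.shiftFactor 3 N (Κ (+ 0)) ⊜ E.complementFactor i N ⊗ E.shiftFactor i N (Κ (+ 0))

  complementFactor-split : ∀ i → i ≤ 3 → ∀ n → shiftFactor 3 n 0 ≈ P.complementFactor i (fromℕ n) * shiftFactor i n 0
  complementFactor-split 0 _ n = solve 1 (complementFactorIdentity 0) refl (fromℕ n)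
  complementFactor-split 1 _ n = solve 1 (complementFactorIdentity 1) refl (fromℕ n)
  complementFactor-split 2 _ n = solve 1 (complementFactorIdentity 2) refl (fromℕ n)
  complementFactor-split 3 _ n = solve 1 (complementFactorIdentity 3) refl (fromℕ n)
  complementFactor-split (suc (suc (suc (suc _)))) (s≤s (s≤s (s≤s ())))

  certificateRecurrence : Recurrence₃
  certificateRecurrence = record
    { coefficient₀ = λ n → P.recurrence₀ (fromℕ n) V
    ; coefficient₁ = λ n → P.recurrence₁ (fromℕ n) V
    ; coefficient₂ = λ n → P.recurrence₂ (fromℕ n) V
    ; coefficient₃ = λ n → P.recurrence₃ (fromℕ n) V
    }

  -- Since shiftFactor 3 n 0 = complementFactor i n · shiftFactor i n 0, this scaling puts all four shifted
  -- summands over the common term τ n.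
  recurrence : Recurrence₃
  recurrence = scale (λ n → shiftFactor 3 n 0) certificateRecurrence

  scaled-term-shift : ∀ i → i ≤ 3 → ∀ n → 2 ≤ n → ∀ k → k ≤ 3 N.+ n → ∀ A →
    A * shiftFactor 3 n 0 * term (i N.+ n) k ≈ A * P.complementFactor i (fromℕ n) * (τ n k * shiftFactor i n k)
  scaled-term-shift i i≤3 n 2≤n k k≤3+n A = begin
    A * shiftFactor 3 n 0 * term (i N.+ n) k         ≈⟨ *-congʳ (*-congˡ (complementFactor-split i i≤3 n)) ⟩
    A * (E * shiftFactor i n 0) * term (i N.+ n) k
      ≈⟨ solve 4 (λ a e c t → a ⊗ (e ⊗ c) ⊗ t ⊜ a ⊗ e ⊗ (t ⊗ c)) refl A E (shiftFactor i n 0) (term (i N.+ n) k) ⟩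
    A * E * (term (i N.+ n) k * shiftFactor i n 0)   ≈⟨ *-congˡ (term-shift i i≤3 n 2≤n k k≤3+n) ⟩
    A * E * (τ n k * shiftFactor i n k)              ∎
    where E = P.complementFactor i (fromℕ n)

  G : ℕ → ℕ → Carrier
  G n k = τ n k * P.certificate (fromℕ n) (fromℕ k) V

  telescoping-identity : ∀ N K V → P.telescopingLHS N K V ≈ P.telescopingRHS N K V
  telescoping-identity = solve 3 (λ N K V → E.telescopingLHS N K V ⊜ E.telescopingRHS N K V) refl

  creative-telescoping : ∀ n → 2 ≤ n → ∀ k → k ≤ 3 N.+ n →
                         apply recurrence (λ m → term m k) n ≈ G n (suc k) - G n k
  creative-telescoping n 2≤n k k≤3+n = *-cancelʳ (denominator≉0 n k (N.<⇒≢ k<3n)) (begin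
    apply recurrence (λ m → term m k) n * δ
      ≈⟨ *-congʳ (+-cong (+-cong (+-cong (shifted 0 z≤n) (shifted 1 (s≤s z≤n))) (shifted 2 (s≤s (s≤s z≤n))))
                         (shifted 3 N.≤-refl)) ⟩
    (A₀ * E 0 * (τ n k * shiftFactor 0 n k) + A₁ * E 1 * (τ n k * shiftFactor 1 n k)
      + A₂ * E 2 * (τ n k * shiftFactor 2 n k) + A₃ * E 3 * (τ n k * shiftFactor 3 n k)) * δ
      ≈⟨ solve 14 (λ a₀ a₁ a₂ a₃ e₀ e₁ e₂ e₃ p₀ p₁ p₂ p₃ t δ →
                     (a₀ ⊗ e₀ ⊗ (t ⊗ p₀) ⊕ a₁ ⊗ e₁ ⊗ (t ⊗ p₁) ⊕ a₂ ⊗ e₂ ⊗ (t ⊗ p₂) ⊕ a₃ ⊗ e₃ ⊗ (t ⊗ p₃)) ⊗ δ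
                   ⊜ t ⊗ ((a₀ ⊗ e₀ ⊗ p₀ ⊕ a₁ ⊗ e₁ ⊗ p₁ ⊕ a₂ ⊗ e₂ ⊗ p₂ ⊕ a₃ ⊗ e₃ ⊗ p₃) ⊗ δ)) refl
           A₀ A₁ A₂ A₃ (E 0) (E 1) (E 2) (E 3)
           (shiftFactor 0 n k) (shiftFactor 1 n k) (shiftFactor 2 n k) (shiftFactor 3 n k) (τ n k) δ ⟩
    τ n k * P.telescopingLHS N K V    ≈⟨ *-congˡ (telescoping-identity N K V) ⟩
    τ n k * P.telescopingRHS N K V
      ≈⟨ solve 5 (λ t ν h′ δ h → t ⊗ (ν ⊗ h′ ⊕ ⊝ (δ ⊗ h)) ⊜ t ⊗ ν ⊗ h′ ⊕ ⊝ (t ⊗ h ⊗ δ)) refl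
           (τ n k) (τNumerator n k) H′ δ H ⟩
    τ n k * τNumerator n k * H′ - G n k * δ  ≈⟨ +-congʳ (*-congʳ (τ-ratio n k (N.<⇒≢ k<3n))) ⟨
    τ n (suc k) * δ * H′ - G n k * δ
      ≈⟨ solve 4 (λ t δ h′ g → t ⊗ δ ⊗ h′ ⊕ ⊝ (g ⊗ δ) ⊜ (t ⊗ h′ ⊕ ⊝ g) ⊗ δ) refl (τ n (suc k)) δ H′ (G n k) ⟩
    (G n (suc k) - G n k) * δ ∎)
    where
    N = fromℕ n
    K = fromℕ k
    δ = denominator n k
    H = P.certificate N K V
    H′ = P.certificate N (fromℕ (suc k)) V
    A₀ = coefficient₀ certificateRecurrence n
    A₁ = coefficient₁ certificateRecurrence n
    A₂ = coefficient₂ certificateRecurrence n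
    A₃ = coefficient₃ certificateRecurrence n
    E : ℕ → Carrier
    E i = P.complementFactor i N
    k<3n : k < 3 N.* n
    k<3n = N.≤-<-trans k≤3+n (3+n<3n n 2≤n)
    shifted : ∀ i → i ≤ 3 → ∀ {A} →
              A * shiftFactor 3 n 0 * term (i N.+ n) k ≈ A * E i * (τ n k * shiftFactor i n k)
    shifted i i≤3 = scaled-term-shift i i≤3 n 2≤n k k≤3+n _

  lhs : ℕ → Carrier
  lhs n = sumTo n (term n)

  lhs-annihilated : ∀ n → 2 ≤ n → apply recurrence lhs n ≈ 0#
  lhs-annihilated n 2≤n = begin
    apply recurrence lhs n
      ≈⟨ apply-cong recurrence {lhs} {λ m → sumTo (3 N.+ n) (term m)} n extend ⟩
    apply recurrence (λ m → sumTo (3 N.+ n) (term m)) n          ≈⟨ apply-sumTo recurrence term (3 N.+ n) n ⟨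
    sumTo (3 N.+ n) (λ k → apply recurrence (λ m → term m k) n)  ≈⟨ sumTo-cong (3 N.+ n) (creative-telescoping n 2≤n) ⟩
    sumTo (3 N.+ n) (λ k → G n (suc k) - G n k)                  ≈⟨ sumTo-telescope (3 N.+ n) (G n) ⟩
    G n (4 N.+ n) - G n 0
      ≈⟨ +-cong (trans (*-congʳ (τ-vanishes n)) (zeroˡ _)) (-‿cong G-at-0) ⟩
    0# - 0#                                                      ≈⟨ -‿inverseʳ 0# ⟩
    0#                                                           ∎
    where
    extend : ∀ i → i ≤ 3 → lhs (i N.+ n) ≈ sumTo (3 N.+ n) (term (i N.+ n))
    extend i i≤3 = sym (sumTo-extend (3 N.+ n) (N.+-monoˡ-≤ n i≤3) (λ k → term-vanishes (i N.+ n) k))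
    G-at-0 : G n 0 ≈ 0#
    G-at-0 = solve 2 (λ N V → 𝟙 ⊗ E.certificate N (Κ (+ 0)) V ⊜ Κ (+ 0)) refl (fromℕ n) V

  b₁ b₂ : Carrier
  b₁ = 1# ÷ fromℕ 3
  b₂ = fromℕ 2 ÷ fromℕ 3

  b₁*3≈1 : b₁ * fromℕ 3 ≈ fromℕ 1
  b₁*3≈1 = ≈-modulo (fromℕ-*⁻¹ 3 (s≤s z≤n))
    (solve 1 (λ t → 𝟙 ⊗ t ⊗ Κ (+ 3) ⊜ Κ (+ 1) ⊕ (Κ (+ 3) ⊗ t ⊕ ⊝ 𝟙) ⊗ 𝟙) refl (fromℕ 3 ⁻¹))

  b₂*3≈2 : b₂ * fromℕ 3 ≈ fromℕ 2
  b₂*3≈2 = ≈-modulo (fromℕ-*⁻¹ 3 (s≤s z≤n))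
    (solve 1 (λ t → Κ (+ 2) ⊗ t ⊗ Κ (+ 3) ⊜ Κ (+ 2) ⊕ (Κ (+ 3) ⊗ t ⊕ ⊝ 𝟙) ⊗ Κ (+ 2)) refl (fromℕ 3 ⁻¹))

  third+i≉0 : ∀ {b} l i → 0 < l → b * fromℕ 3 ≈ fromℕ l → b + fromℕ i ≉ 0#
  third+i≉0 {b} l i 0<l b*3≈l = *-≉0ˡ (≉0-resp-≈ tripled (3n+l≉0 i l 0<l))
    where
    tripled : fromℕ 3 * fromℕ i + fromℕ l ≈ (b + fromℕ i) * fromℕ 3
    tripled = begin
      fromℕ 3 * fromℕ i + fromℕ l          ≈⟨ +-congˡ b*3≈l ⟨
      fromℕ 3 * fromℕ i + b * fromℕ 3      ≈⟨ solve 2 (λ i b → Κ (+ 3) ⊗ i ⊕ b ⊗ Κ (+ 3) ⊜ (b ⊕ i) ⊗ Κ (+ 3)) refl (fromℕ i) b ⟩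
      (b + fromℕ i) * fromℕ 3              ∎

  bracketDenominator : ℕ → Carrier
  bracketDenominator m = P.bracketDenominator (fromℕ m)

  bracketNumerator : ℕ → ℕ → Carrier
  bracketNumerator j m = P.bracketNumerator j (fromℕ m) U

  bracketDenominator≉0 : ∀ m → bracketDenominator m ≉ 0#
  bracketDenominator≉0 m = *-≉0 (3n+l≉0 m 1 (s≤s z≤n)) (3n+l≉0 m 2 (s≤s z≤n))

  B : Carrier → Carrier → ℕ → Carrier
  B a₁ a₂ = bracket a₁ a₂ b₁ b₂

  B-ratio : ∀ a₁ a₂ j → (∀ m → (a₁ + fromℕ m) * (a₂ + fromℕ m) * fromℕ 9 ≈ bracketNumerator j m) →
            ∀ m → B a₁ a₂ (suc m) * bracketDenominator m ≈ B a₁ a₂ m * bracketNumerator j m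
  B-ratio a₁ a₂ j numerator9 m = begin
    B a₁ a₂ (suc m) * bracketDenominator m      ≈⟨ *-congˡ β9≈denominator ⟨
    B a₁ a₂ (suc m) * (β * fromℕ 9)             ≈⟨ *-assoc _ _ _ ⟨
    B a₁ a₂ (suc m) * β * fromℕ 9               ≈⟨ *-congʳ (bracket-ratio a₁ a₂ b₁ b₂ m Y≉0 β≉0) ⟩
    B a₁ a₂ m * ((a₁ + M) * (a₂ + M)) * fromℕ 9 ≈⟨ *-assoc _ _ _ ⟩
    B a₁ a₂ m * ((a₁ + M) * (a₂ + M) * fromℕ 9) ≈⟨ *-congˡ (numerator9 m) ⟩
    B a₁ a₂ m * bracketNumerator j m            ∎
    where
    M = fromℕ m
    β = (b₁ + M) * (b₂ + M)
    b₁+i≉0 : ∀ i → b₁ + fromℕ i ≉ 0#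
    b₁+i≉0 i = third+i≉0 1 i (s≤s z≤n) b₁*3≈1
    b₂+i≉0 : ∀ i → b₂ + fromℕ i ≉ 0#
    b₂+i≉0 i = third+i≉0 2 i (s≤s z≤n) b₂*3≈2
    Y≉0 : poch b₁ m * poch b₂ m ≉ 0#
    Y≉0 = *-≉0 (poch-≉0 b₁ m (λ i _ → b₁+i≉0 i)) (poch-≉0 b₂ m (λ i _ → b₂+i≉0 i))
    β≉0 : β ≉ 0#
    β≉0 = *-≉0 (b₁+i≉0 m) (b₂+i≉0 m)
    β9≈denominator : β * fromℕ 9 ≈ bracketDenominator m
    β9≈denominator = ≈-modulo (fromℕ-*⁻¹ 3 (s≤s z≤n))
      (solve 2 (λ t M → (𝟙 ⊗ t ⊕ M) ⊗ (Κ (+ 2) ⊗ t ⊕ M) ⊗ Κ (+ 9)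
                      ⊜ E.bracketDenominator M ⊕ (Κ (+ 3) ⊗ t ⊕ ⊝ 𝟙) ⊗ (Κ (+ 6) ⊗ t ⊕ Κ (+ 2) ⊕ Κ (+ 9) ⊗ M))
               refl (fromℕ 3 ⁻¹) M)

  B₁ B₂ B₃ : ℕ → Carrier
  B₁ = B (b₁ + x) (b₂ - x)
  B₂ = B (b₂ + x) (b₁ - x)
  B₃ = B (1# + x) (- x)

  B₁-ratio : ∀ m → B₁ (suc m) * bracketDenominator m ≈ B₁ m * bracketNumerator 1 m
  B₁-ratio = B-ratio (b₁ + x) (b₂ - x) 1 (λ m → ≈-modulo (fromℕ-*⁻¹ 3 (s≤s z≤n))
    (solve 3 (λ t X M → (𝟙 ⊗ t ⊕ X ⊕ M) ⊗ (Κ (+ 2) ⊗ t ⊕ ⊝ X ⊕ M) ⊗ Κ (+ 9)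
                      ⊜ E.bracketNumerator 1 M (Κ (+ 3) ⊗ X)
                        ⊕ (Κ (+ 3) ⊗ t ⊕ ⊝ 𝟙) ⊗ (Κ (+ 6) ⊗ t ⊕ Κ (+ 2) ⊕ Κ (+ 3) ⊗ X ⊕ Κ (+ 9) ⊗ M))
       refl (fromℕ 3 ⁻¹) x (fromℕ m)))

  B₂-ratio : ∀ m → B₂ (suc m) * bracketDenominator m ≈ B₂ m * bracketNumerator 2 m
  B₂-ratio = B-ratio (b₂ + x) (b₁ - x) 2 (λ m → ≈-modulo (fromℕ-*⁻¹ 3 (s≤s z≤n))
    (solve 3 (λ t X M → (Κ (+ 2) ⊗ t ⊕ X ⊕ M) ⊗ (𝟙 ⊗ t ⊕ ⊝ X ⊕ M) ⊗ Κ (+ 9)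
                      ⊜ E.bracketNumerator 2 M (Κ (+ 3) ⊗ X)
                        ⊕ (Κ (+ 3) ⊗ t ⊕ ⊝ 𝟙) ⊗ (Κ (+ 6) ⊗ t ⊕ Κ (+ 2) ⊕ ⊝ (Κ (+ 3) ⊗ X) ⊕ Κ (+ 9) ⊗ M))
       refl (fromℕ 3 ⁻¹) x (fromℕ m)))

  B₃-ratio : ∀ m → B₃ (suc m) * bracketDenominator m ≈ B₃ m * bracketNumerator 3 m
  B₃-ratio = B-ratio (1# + x) (- x) 3 (λ m →
    solve 2 (λ X M → (𝟙 ⊕ X ⊕ M) ⊗ (⊝ X ⊕ M) ⊗ Κ (+ 9) ⊜ E.bracketNumerator 3 M (Κ (+ 3) ⊗ X)) refl x (fromℕ m))

  rhs : ℕ → Carrier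
  rhs n = ((1# + fromℕ 3 * x) ÷ fromℕ 2) * B₁ n + (1# ÷ fromℕ 2) * B₂ n - ((fromℕ 3 * x) ÷ fromℕ 2) * B₃ n

  rhs-annihilated : ∀ n → apply recurrence rhs n ≈ 0#
  rhs-annihilated n = begin
    apply recurrence rhs n                          ≈⟨ apply-scale (λ m → shiftFactor 3 m 0) certificateRecurrence rhs n ⟩
    shiftFactor 3 n 0 * apply certificateRecurrence rhs n  ≈⟨ *-congˡ (combination n) ⟩
    shiftFactor 3 n 0 * 0#                          ≈⟨ zeroʳ _ ⟩
    0#                                              ∎
    where
    L = certificateRecurrence
    annihilated₁ : ∀ n → apply L B₁ n ≈ 0#
    annihilated₁ n = hypergeometric-annihilated L n B₁-ratio bracketDenominator≉0
      (solve 2 (λ N X → E.bracketRecurrenceCheck 1 N (Κ (+ 3) ⊗ X) ⊜ Κ (+ 0)) refl (fromℕ n) x)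
    annihilated₂ : ∀ n → apply L B₂ n ≈ 0#
    annihilated₂ n = hypergeometric-annihilated L n B₂-ratio bracketDenominator≉0
      (solve 2 (λ N X → E.bracketRecurrenceCheck 2 N (Κ (+ 3) ⊗ X) ⊜ Κ (+ 0)) refl (fromℕ n) x)
    annihilated₃ : ∀ n → apply L B₃ n ≈ 0#
    annihilated₃ n = hypergeometric-annihilated L n B₃-ratio bracketDenominator≉0
      (solve 2 (λ N X → E.bracketRecurrenceCheck 3 N (Κ (+ 3) ⊗ X) ⊜ Κ (+ 0)) refl (fromℕ n) x)
    combination : ∀ n → apply L rhs n ≈ 0#
    combination = annihilates-+ L (annihilates-+ L (annihilates-*ˡ L _ annihilated₁) (annihilates-*ˡ L _ annihilated₂))
                                  (annihilates-neg L (annihilates-*ˡ L _ annihilated₃))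

  leading≉0 : ∀ n → coefficient₃ recurrence n ≉ 0#
  leading≉0 n = *-≉0 A₃≉0 C₃≉0
    where
    3n+ : ∀ l → fromℕ 3 * fromℕ n + fromℕ (suc l) ≉ 0#
    3n+ l = 3n+l≉0 n (suc l) (s≤s z≤n)
    A₃≉0 : P.recurrence₃ (fromℕ n) V ≉ 0#
    A₃≉0 = ≉0-resp-≈ (solve 2 (λ N V → ((((((Κ (+ 3) ⊗ N ⊕ Κ (+ 1)) ⊗ (Κ (+ 3) ⊗ N ⊕ Κ (+ 2))) ⊗ (Κ (+ 3) ⊗ N ⊕ Κ (+ 4)))
                                          ⊗ (Κ (+ 3) ⊗ N ⊕ Κ (+ 5))) ⊗ (Κ (+ 3) ⊗ N ⊕ Κ (+ 7))) ⊗ (Κ (+ 3) ⊗ N ⊕ Κ (+ 8)))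
                                        ⊜ E.recurrence₃ N V) refl (fromℕ n) V)
                     (*-≉0 (*-≉0 (*-≉0 (*-≉0 (*-≉0 (3n+ 0) (3n+ 1)) (3n+ 3)) (3n+ 4)) (3n+ 6)) (3n+ 7))
    C₃≉0 : shiftFactor 3 n 0 ≉ 0#
    C₃≉0 = *-≉0 1≉0 (∏<-≉0 9 (λ j _ → ≉0-resp-≈ (negated j) (-‿≉0 (3n+ j))))
      where
      negated : ∀ j → - (fromℕ 3 * fromℕ n + fromℕ (suc j)) ≈ fromℕ 0 - fromℕ 3 * fromℕ n - fromℕ (suc j)
      negated j = solve 2 (λ a b → ⊝ (a ⊕ b) ⊜ Κ (+ 0) ⊕ ⊝ a ⊕ ⊝ b) refl (fromℕ 3 * fromℕ n) (fromℕ (suc j))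

  lhs-cleared : ∀ n → lhs n * ∏< n (denominator n) ≈ clearedSum (numerator n) (denominator n) n
  lhs-cleared n = sumTo-clearedSum n (hypergeometricTerm-zero a b (- fromℕ n) d (e n) z)
    (λ k k<n → term-ratio n k (N.<-≤-trans k<n (N.m≤n*m n 3)))

  rhs-cleared : ∀ n → rhs n * (∏< n bracketDenominator * fromℕ 2)
                      ≈ (1# + U) * ∏< n (bracketNumerator 1) + ∏< n (bracketNumerator 2) - U * ∏< n (bracketNumerator 3)
  rhs-cleared n = begin
    rhs n * (D * fromℕ 2)
      ≈⟨ ≈-modulo (fromℕ-*⁻¹ 2 (s≤s z≤n))
           (solve 6 (λ X h p q r D → ((𝟙 ⊕ Κ (+ 3) ⊗ X) ⊗ h ⊗ p ⊕ 𝟙 ⊗ h ⊗ q ⊕ ⊝ (Κ (+ 3) ⊗ X ⊗ h ⊗ r)) ⊗ (D ⊗ Κ (+ 2))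
                                    ⊜ ((𝟙 ⊕ Κ (+ 3) ⊗ X) ⊗ (p ⊗ D) ⊕ q ⊗ D ⊕ ⊝ (Κ (+ 3) ⊗ X ⊗ (r ⊗ D)))
                                      ⊕ (Κ (+ 2) ⊗ h ⊕ ⊝ 𝟙) ⊗ ((𝟙 ⊕ Κ (+ 3) ⊗ X) ⊗ (p ⊗ D) ⊕ q ⊗ D ⊕ ⊝ (Κ (+ 3) ⊗ X ⊗ (r ⊗ D))))
                  refl x (fromℕ 2 ⁻¹) (B₁ n) (B₂ n) (B₃ n) D) ⟩
    (1# + U) * (B₁ n * D) + B₂ n * D - U * (B₃ n * D)
      ≈⟨ +-cong (+-cong (*-congˡ (closedForm {j = 1} B₁-ratio)) (closedForm {j = 2} B₂-ratio))
                (-‿cong (*-congˡ (closedForm {j = 3} B₃-ratio))) ⟩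
    (1# + U) * ∏< n (bracketNumerator 1) + ∏< n (bracketNumerator 2) - U * ∏< n (bracketNumerator 3) ∎
    where
    D = ∏< n bracketDenominator
    closedForm : ∀ {a₁ a₂ j} → (∀ m → B a₁ a₂ (suc m) * bracketDenominator m ≈ B a₁ a₂ m * bracketNumerator j m) →
                 B a₁ a₂ n * D ≈ ∏< n (bracketNumerator j)
    closedForm {a₁} {a₂} ratio = trans (hypergeometric-closedForm n (λ m _ → ratio m))
                                       (trans (*-congʳ (bracket-zero a₁ a₂ b₁ b₂)) (*-identityˡ _))

  lhs≈rhs-by-clearing : ∀ n →
    clearedSum (numerator n) (denominator n) n * (∏< n bracketDenominator * fromℕ 2)
      ≈ ((1# + U) * ∏< n (bracketNumerator 1) + ∏< n (bracketNumerator 2) - U * ∏< n (bracketNumerator 3)) * ∏< n (denominator n) →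
    lhs n ≈ rhs n
  lhs≈rhs-by-clearing n cleared = *-cancelʳ (*-≉0 Dₗ≉0 Dᵣ≉0) (begin
    lhs n * (Dₗ * Dᵣ)     ≈⟨ *-assoc _ _ _ ⟨
    lhs n * Dₗ * Dᵣ       ≈⟨ *-congʳ (lhs-cleared n) ⟩
    clearedSum (numerator n) (denominator n) n * Dᵣ ≈⟨ cleared ⟩
    _ * Dₗ                ≈⟨ *-congʳ (rhs-cleared n) ⟨
    rhs n * Dᵣ * Dₗ       ≈⟨ solve 3 (λ r a b → r ⊗ b ⊗ a ⊜ r ⊗ (a ⊗ b)) refl (rhs n) Dₗ Dᵣ ⟩
    rhs n * (Dₗ * Dᵣ)     ∎)
    where
    Dₗ = ∏< n (denominator n)
    Dᵣ = ∏< n bracketDenominator * fromℕ 2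
    Dₗ≉0 : Dₗ ≉ 0#
    Dₗ≉0 = ∏<-≉0 n (λ k k<n → denominator≉0 n k (N.<⇒≢ (N.<-≤-trans k<n (N.m≤n*m n 3))))
    Dᵣ≉0 : Dᵣ ≉ 0#
    Dᵣ≉0 = *-≉0 (∏<-≉0 n (λ m _ → bracketDenominator≉0 m)) (fromℕ-≉0 2 (s≤s z≤n))

  initialValueIdentity : ℕ → Expr ℤ 1 → Expr ℤ 1 × Expr ℤ 1
  initialValueIdentity n X =
      ES.clearedSum (λ k → E.termNumerator (Κ (+ n)) (Κ (+ k)) V′) (λ k → E.termDenominator (Κ (+ n)) (Κ (+ k))) n
        ⊗ (ES.∏< n (λ m → E.bracketDenominator (Κ (+ m))) ⊗ Κ (+ 2))
    ⊜ ((𝟙 ⊕ U′) ⊗ ES.∏< n (λ m → E.bracketNumerator 1 (Κ (+ m)) U′)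
         ⊕ ES.∏< n (λ m → E.bracketNumerator 2 (Κ (+ m)) U′)
         ⊕ ⊝ (U′ ⊗ ES.∏< n (λ m → E.bracketNumerator 3 (Κ (+ m)) U′)))
        ⊗ ES.∏< n (λ k → E.termDenominator (Κ (+ n)) (Κ (+ k)))
    where
    U′ = Κ (+ 3) ⊗ X
    V′ = U′ ⊗ (𝟙 ⊕ U′)

  lhs≈rhs : ∀ n → lhs n ≈ rhs n
  lhs≈rhs = recurrence-uniqueness recurrence 2 (λ n _ → leading≉0 n) lhs-annihilated (λ n _ → rhs-annihilated n) initial
    where
    initial : ∀ n → n < 5 → lhs n ≈ rhs n
    initial 0 _ = lhs≈rhs-by-clearing 0 (solve 1 (initialValueIdentity 0) refl x)
    initial 1 _ = lhs≈rhs-by-clearing 1 (solve 1 (initialValueIdentity 1) refl x)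
    initial 2 _ = lhs≈rhs-by-clearing 2 (solve 1 (initialValueIdentity 2) refl x)
    initial 3 _ = lhs≈rhs-by-clearing 3 (solve 1 (initialValueIdentity 3) refl x)
    initial 4 _ = lhs≈rhs-by-clearing 4 (solve 1 (initialValueIdentity 4) refl x)
    initial (suc (suc (suc (suc (suc _))))) (s≤s (s≤s (s≤s (s≤s (s≤s ())))))

corollary14 : ∀ {c ℓ} (F : CharZeroField c ℓ) → let open CharZeroField F in
    ∀ (n : ℕ) (x : Carrier) →
      F32 (fromℕ 3 * x) (- 1# - fromℕ 3 * x) n (- (1# ÷ fromℕ 2)) (- fromℕ (3 N.* n)) (fromℕ 3 ÷ fromℕ 4)
      ≈ ((1# + fromℕ 3 * x) ÷ fromℕ 2) * bracket (1# ÷ fromℕ 3 + x) (fromℕ 2 ÷ fromℕ 3 - x) (1# ÷ fromℕ 3) (fromℕ 2 ÷ fromℕ 3) n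
        + (1# ÷ fromℕ 2) * bracket (fromℕ 2 ÷ fromℕ 3 + x) (1# ÷ fromℕ 3 - x) (1# ÷ fromℕ 3) (fromℕ 2 ÷ fromℕ 3) n
        - ((fromℕ 3 * x) ÷ fromℕ 2) * bracket (1# + x) (- x) (1# ÷ fromℕ 3) (fromℕ 2 ÷ fromℕ 3) n
corollary14 F n x = Corollary14.lhs≈rhs F x n
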